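{- Let $n\ge 3$ be an integer. The minimum number of Hamilton cycles in a hamiltonian threshold graph of order $n$ is $2^{\lfloor (n-3)/2\rfloor}$, and, up to isomorphism, this minimum number is attained only by the graph $G_n$.
   Context: A finite simple graph $G$ is a threshold graph if there exist a function $f:V(G)\to\mathbb{R}$ with nonnegative values and a nonnegative real number $t$ such that for any two distinct vertices $u,v$, $u$ and $v$ are adjacent if and only if $f(u)+f(v)>t$. For an integer $n\ge 3$, $G_n$ denotes the graph (unique up to isomorphism) with degree sequence $n-1,n-1,n-2,\ldots,\lceil n/2\rceil,\lceil n/2\rceil,\ldots,3,2$ having $n-2$ distinct degrees; that is, its $n$ degrees are the integers $2,3,\ldots,n-1$, each occurring once, except that $n-1$ and $\lceil n/2\rceil$ each occur twice (for $n=3$, where these two values coincide, the degree sequence is $2,2,2$). $G_n$ is a hamiltonian threshold graph. Hamilton cycles are counted as distinct subgraphs; graphs are considered up to isomorphism.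
   Formalization: In the definition of threshold graph, the vertex weights f and the threshold t are taken to be nonnegative rational numbers instead of nonnegative real numbers (for finite graphs this gives the same class of graphs). -}

module Defs where

open import Data.Nat using (ℕ; zero; suc; _+_; _∸_; ⌈_/2⌉)
open import Data.Fin using (Fin; toℕ)
open import Data.Bool using (Bool; true; false; if_then_else_)
open import Data.Vec using (Vec; lookup)
open import Data.List using (List; _∷_; map; upTo; allFin; length)
open import Data.Nat.ListAction using (sum)
open import Data.List.Relation.Unary.Unique.Propositional using (Unique)
open import Data.List.Membership.Propositional using (_∈_)
open import Data.List.Relation.Binary.Permutation.Propositional using (_↭_)
open import Data.Fin.Permutation using (Permutation′; _⟨$⟩ʳ_)
open import Data.Rational using (ℚ; 0ℚ; _<_; _≤_) renaming (_+_ to _+ℚ_)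
open import Data.Product using (Σ; ∃; _×_)
open import Data.Sum using (_⊎_)
open import Relation.Binary.PropositionalEquality using (_≡_; _≢_)
open import Function.Bundles using (_⇔_)

record SimpleGraph (n : ℕ) : Set where
  field
    adj     : Fin n → Fin n → Bool
    adj-sym : ∀ u v → adj u v ≡ adj v u
    adj-irr : ∀ v → adj v v ≡ false
open SimpleGraph public

IsThreshold : ∀ {n} → SimpleGraph n → Set
IsThreshold {n} G =
  Σ (Fin n → ℚ) λ f → Σ ℚ λ t →
    (∀ v → 0ℚ ≤ f v) × (0ℚ ≤ t) ×
    (∀ u v → u ≢ v → (adj G u v ≡ true ⇔ t < f u +ℚ f v))

EdgeSet : ℕ → Set
EdgeSet n = Vec (Vec Bool n) n

_∋ₑ_,_ : ∀ {n} → EdgeSet n → Fin n → Fin n → Bool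
E ∋ₑ x , y = lookup (lookup E x) y

CycSucc : (n : ℕ) → Fin n → Fin n → Set
CycSucc n i j = (suc (toℕ i) ≡ toℕ j) ⊎ ((suc (toℕ i) ≡ n) × (toℕ j ≡ 0))

Consecutive : ∀ {n} → Permutation′ n → Fin n → Fin n → Set
Consecutive {n} σ x y =
  ∃ λ i → ∃ λ j → CycSucc n i j ×
    (((σ ⟨$⟩ʳ i ≡ x) × (σ ⟨$⟩ʳ j ≡ y)) ⊎ ((σ ⟨$⟩ʳ i ≡ y) × (σ ⟨$⟩ʳ j ≡ x)))

IsHamCycle : ∀ {n} → SimpleGraph n → EdgeSet n → Set
IsHamCycle {n} G E =
  (∀ x y → E ∋ₑ x , y ≡ true → adj G x y ≡ true) ×
  Σ (Permutation′ n) λ σ → ∀ x y → (E ∋ₑ x , y ≡ true ⇔ Consecutive σ x y)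

Hamiltonian : ∀ {n} → SimpleGraph n → Set
Hamiltonian {n} G = Σ (EdgeSet n) λ E → IsHamCycle G E

NumHamCycles : ∀ {n} → SimpleGraph n → ℕ → Set
NumHamCycles {n} G k =
  Σ (List (EdgeSet n)) λ L →
    Unique L × (∀ E → (E ∈ L ⇔ IsHamCycle G E)) × (length L ≡ k)

deg : ∀ {n} → SimpleGraph n → Fin n → ℕ
deg {n} G v = sum (map (λ w → if adj G v w then 1 else 0) (allFin n))

GnDegrees : ℕ → List ℕ
GnDegrees n = (n ∸ 1) ∷ ⌈ n /2⌉ ∷ map (λ i → i + 2) (upTo (n ∸ 2))

HasGnDegreeSequence : ∀ {n} → SimpleGraph n → Set
HasGnDegreeSequence {n} G = map (deg G) (allFin n) ↭ GnDegrees n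

_≅_ : ∀ {n} → SimpleGraph n → SimpleGraph n → Set
_≅_ {n} G H = Σ (Permutation′ n) λ π → ∀ x y → adj G (π ⟨$⟩ʳ x) (π ⟨$⟩ʳ y) ≡ adj H x y

{-# OPTIONS --safe #-}

module Submission where

-- Label the vertices 0, …, m + 2 (so n = m + 3) by increasing weight. Then Gₙ is the graph with x ~ y iff
-- x + y ≥ m + 1. In a Hamiltonian threshold graph a missing edge of this kind would make {0, …, x} an independent
-- set with too few neighbours, so every such graph contains Gₙ as a spanning subgraph.
--
-- In Gₙ the vertex 0 has only the neighbours m + 1 and m + 2, so a Hamilton cycle is m + 2, 0, m + 1 followed by a
-- Hamiltonian path on {1, …, m} for the same relation. After a shift by one this is a path on {0, …, m - 1} with
-- x ~ y iff x + y ≥ m - 1; there 0 must be an end of the path and m - 1 its neighbour, which leaves two choices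
-- (the end) and a path of the same kind on m - 2 vertices: 2 ^ ⌊ m /2⌋ paths in all.
--
-- A graph properly containing Gₙ has an edge xy with x + y = m, and then a Hamilton cycle through that edge.

open import Defs
open import Data.Bool using (Bool; true; false; if_then_else_)
open import Data.Bool.Properties using (⇔→≡)
open import Data.Empty using (⊥)
open import Data.Fin using (Fin; zero; suc; toℕ; fromℕ; fromℕ<; inject₁; opposite; punchOut; combine; remQuot; cast; inject≤; punchIn; _≟_)
open import Data.Fin.Properties using
  ( any?; suc-injective; toℕ-injective; toℕ<n; toℕ-fromℕ; toℕ-fromℕ<; toℕ-inject₁; fromℕ<-injective; punchOut-injective
  ; injective⇒≤; opposite-prop; opposite-involutive; combine-remQuot; remQuot-combine
  ; <-cmp; punchInᵢ≢i; toℕ-cast; cast-trans; cast-is-id; toℕ-inject≤; inject≤-injective)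
open import Data.Fin.Permutation as Permutation using (Permutation′; _⟨$⟩ʳ_; _⟨$⟩ˡ_; _∘ₚ_; flip; cast-id; permutation; inverseˡ; inverseʳ)
open import Data.List as List using (List; []; _∷_; _++_; length; allFin; upTo; applyUpTo)
open import Data.List.Membership.Propositional using (_∈_)
open import Data.List.Membership.Propositional.Properties using (∈-tabulate⁺; ∈-tabulate⁻)
import Data.List.Properties as List
open import Data.List.Relation.Binary.Permutation.Propositional using (_↭_; ↭-sym; ↭-trans; ↭⇒↭ₛ; prep)
open import Data.List.Relation.Binary.Permutation.Propositional.Properties using (↭-length; ++-comm; shift)
open import Data.List.Relation.Binary.Permutation.Homogeneous using (onIndices)
import Data.List.Relation.Binary.Permutation.Setoid.Properties as Permutationₛ
open import Data.List.Relation.Unary.Any using (index)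
open import Data.List.Relation.Unary.Any.Properties using (lookup-index)
open import Data.List.Relation.Unary.Sorted.TotalOrder.Properties using (lookup-mono-≤)
import Data.List.Relation.Unary.Unique.Propositional.Properties as Unique
import Data.List.Sort
open import Data.Nat using (ℕ; zero; suc; pred; _+_; _≤_; _<_; _^_; _∸_; ⌊_/2⌋; ⌈_/2⌉; z≤n; s≤s; s≤s⁻¹)
import Data.Nat.ListAction as ListAction
import Data.Nat.Properties as ℕ
open import Data.Product as Product using (Σ; ∃; ∃₂; _×_; _,_; proj₁; proj₂)
import Data.Rational as ℚ
import Data.Rational.Properties as ℚ
open import Data.Rational using (ℚ; 0ℚ; 1ℚ)
open import Data.Sum as Sum using (_⊎_; inj₁; inj₂)
open import Data.Vec using (Vec; lookup; tabulate)
open import Data.Vec.Properties using (lookup∘tabulate; tabulate∘lookup; tabulate-cong)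
open import Function using (_∘_; id; Injective; _⇔_; mk⇔; Equivalence)
open import Relation.Binary.Bundles using (DecTotalOrder)
open import Relation.Binary.Definitions using (tri<; tri≈; tri>)
open import Relation.Binary.PropositionalEquality
open import Relation.Nullary using (Dec; yes; no; does; contradiction)
open import Relation.Nullary.Decidable using (_×-dec_; _⊎-dec_; ¬?; dec-true; dec-false; toWitness)
open import Algebra.Properties.CommutativeMonoid.Sum ℕ.+-0-commutativeMonoid using (sum; sum-cong-≗; sum-permute; sum-remove)

private
  variable
    m n : ℕ

-- Permutations of Fin n

-- Pigeonhole: if `y` were missed, punching it out of the codomain would inject `Fin (suc n)` into
-- `Fin n`.
injective⇒surjective : {f : Fin n → Fin n} → Injective _≡_ _≡_ f → ∀ y → ∃ λ x → f x ≡ y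
injective⇒surjective {suc n} {f} f-inj y with any? (λ x → f x ≟ y)
... | yes hit = hit
... | no miss = contradiction (injective⇒≤ {f = λ x → punchOut (avoid x)} punch-inj) ℕ.1+n≰n
  where
  avoid : ∀ x → y ≢ f x
  avoid x y≡fx = miss (x , sym y≡fx)
  punch-inj : Injective _≡_ _≡_ (λ x → punchOut (avoid x))
  punch-inj eq = f-inj (punchOut-injective (avoid _) (avoid _) eq)

toPermutation : (f : Fin n → Fin n) → Injective _≡_ _≡_ f → Permutation′ n
toPermutation f f-inj = permutation f (proj₁ ∘ f-sur) (proj₂ ∘ f-sur) (λ x → f-inj (proj₂ (f-sur (f x))))
  where f-sur = injective⇒surjective f-inj

⟨$⟩ʳ-injective : (σ : Permutation′ n) → Injective _≡_ _≡_ (σ ⟨$⟩ʳ_)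
⟨$⟩ʳ-injective σ eq = trans (sym (inverseˡ σ)) (trans (cong (σ ⟨$⟩ˡ_) eq) (inverseˡ σ))

-- The cyclic successor

CycSucc-functional : ∀ {i j k : Fin n} → CycSucc n i j → CycSucc n i k → j ≡ k
CycSucc-functional (inj₁ p) (inj₁ q) = toℕ-injective (trans (sym p) q)
CycSucc-functional {j = j} (inj₁ p) (inj₂ (q , _)) = contradiction (trans (sym p) q) (ℕ.<⇒≢ (toℕ<n j))
CycSucc-functional {k = k} (inj₂ (p , _)) (inj₁ q) = contradiction (trans (sym q) p) (ℕ.<⇒≢ (toℕ<n k))
CycSucc-functional (inj₂ (_ , p)) (inj₂ (_ , q)) = toℕ-injective (trans p (sym q))

CycSucc-injective : ∀ {i j k : Fin n} → CycSucc n i k → CycSucc n j k → i ≡ j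
CycSucc-injective (inj₁ p) (inj₁ q) = toℕ-injective (ℕ.suc-injective (trans p (sym q)))
CycSucc-injective (inj₁ p) (inj₂ (_ , q)) with () ← trans p q
CycSucc-injective (inj₂ (_ , p)) (inj₁ q) with () ← trans q p
CycSucc-injective (inj₂ (p , _)) (inj₂ (q , _)) = toℕ-injective (ℕ.suc-injective (trans p (sym q)))

CycSucc-total : (i : Fin n) → ∃ (CycSucc n i)
CycSucc-total {suc n} i with suc (toℕ i) ℕ.≟ suc n
... | yes last = zero , inj₂ (last , refl)
... | no ¬last = fromℕ< i+1<n , inj₁ (sym (toℕ-fromℕ< i+1<n))
  where i+1<n = ℕ.≤∧≢⇒< (toℕ<n i) ¬last

next : Fin n → Fin n
next i = proj₁ (CycSucc-total i)

next-CycSucc : (i : Fin n) → CycSucc n i (next i)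
next-CycSucc i = proj₂ (CycSucc-total i)

next-unique : ∀ {i j : Fin n} → CycSucc n i j → next i ≡ j
next-unique = CycSucc-functional (next-CycSucc _)

rotation : Permutation′ n
rotation = toPermutation next λ {i} {j} eq →
  CycSucc-injective (next-CycSucc i) (subst (CycSucc _ j) (sym eq) (next-CycSucc j))

toℕ-opposite-suc : ∀ {n} {i j : Fin n} → suc (toℕ i) ≡ toℕ j → suc (toℕ (opposite j)) ≡ toℕ (opposite i)
toℕ-opposite-suc {n} {i} {j} eq = begin
  suc (toℕ (opposite j))   ≡⟨ cong suc (opposite-prop j) ⟩
  suc (n ∸ suc (toℕ j))    ≡⟨ ℕ.+-∸-assoc 1 (toℕ<n j) ⟨
  suc n ∸ suc (toℕ j)      ≡⟨ cong (n ∸_) eq ⟨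
  n ∸ suc (toℕ i)          ≡⟨ opposite-prop i ⟨
  toℕ (opposite i)         ∎
  where open ≡-Reasoning

-- Negation modulo `suc n`. Since position 0 stays fixed, a cyclic order can be reversed without
-- changing its first vertex.
reflect : Fin (suc n) → Fin (suc n)
reflect zero    = zero
reflect (suc i) = suc (opposite i)

reflect-involutive : (i : Fin (suc n)) → reflect (reflect i) ≡ i
reflect-involutive zero    = refl
reflect-involutive (suc i) = cong suc (opposite-involutive i)

reflection : Permutation′ (suc n)
reflection = permutation reflect reflect reflect-involutive reflect-involutive

opposite-last : {i : Fin n} → suc (toℕ i) ≡ n → toℕ (opposite i) ≡ 0
opposite-last {n} {i} eq = trans (opposite-prop i) (trans (cong (n ∸_) eq) (ℕ.n∸n≡0 n))

reflect-CycSucc : ∀ {i j : Fin (suc n)} → CycSucc (suc n) i j → CycSucc (suc n) (reflect j) (reflect i)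
reflect-CycSucc {i = zero}  {suc zero} (inj₁ _) = inj₂ (cong (λ t → suc (suc t)) (toℕ-fromℕ _) , refl)
reflect-CycSucc {i = suc i} {suc j} (inj₁ eq) = inj₁ (cong suc (toℕ-opposite-suc (ℕ.suc-injective eq)))
reflect-CycSucc {i = zero}  {zero}  (inj₂ (eq , _)) = inj₂ (eq , refl)
reflect-CycSucc {i = suc i} {zero}  (inj₂ (eq , _)) = inj₁ (cong suc (sym (opposite-last (ℕ.suc-injective eq))))

-- Cyclic orders with the same edges

_⊑_ : Permutation′ n → Permutation′ n → Set
σ ⊑ τ = ∀ {x y} → Consecutive σ x y → Consecutive τ x y

_∼_ : Permutation′ n → Permutation′ n → Set
σ ∼ τ = σ ⊑ τ × τ ⊑ σ

-- `ψ` acts on positions, before `σ`. Allowing a step to be kept or turned round treats rotations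
-- and the reflection alike.
∘-⊑ : (ψ σ : Permutation′ n) →
      (∀ {i j} → CycSucc n i j → CycSucc n (ψ ⟨$⟩ʳ i) (ψ ⟨$⟩ʳ j) ⊎ CycSucc n (ψ ⟨$⟩ʳ j) (ψ ⟨$⟩ʳ i)) →
      (ψ ∘ₚ σ) ⊑ σ
∘-⊑ ψ σ pres (i , j , ij , e) with pres ij | e
... | inj₁ fw | _      = _ , _ , fw , e
... | inj₂ bw | inj₁ (p , q) = _ , _ , bw , inj₂ (q , p)
... | inj₂ bw | inj₂ (p , q) = _ , _ , bw , inj₁ (q , p)

≗⇒⊑ : {σ τ : Permutation′ n} → (∀ i → σ ⟨$⟩ʳ i ≡ τ ⟨$⟩ʳ i) → σ ⊑ τ
≗⇒⊑ eq (i , j , ij , inj₁ (p , q)) = i , j , ij , inj₁ (trans (sym (eq i)) p , trans (sym (eq j)) q)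
≗⇒⊑ eq (i , j , ij , inj₂ (p , q)) = i , j , ij , inj₂ (trans (sym (eq i)) p , trans (sym (eq j)) q)

∼-trans : {ρ σ τ : Permutation′ n} → ρ ∼ σ → σ ∼ τ → ρ ∼ τ
∼-trans (ρσ , σρ) (στ , τσ) = (λ e → στ (ρσ e)) , (λ e → σρ (τσ e))

rotation-∼ : (σ : Permutation′ n) → (rotation ∘ₚ σ) ∼ σ
rotation-∼ σ =
    ∘-⊑ rotation σ (λ {i} ij → inj₁ (subst (λ t → CycSucc _ t _) (sym (next-unique ij)) (next-CycSucc _)))
  , λ e → ∘-⊑ (flip rotation) (rotation ∘ₚ σ) back
        (≗⇒⊑ {σ = σ} {flip rotation ∘ₚ rotation ∘ₚ σ} (λ i → cong (σ ⟨$⟩ʳ_) (sym (inverseʳ rotation))) e)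
  where
  back : ∀ {i j} → CycSucc _ i j → CycSucc _ (rotation ⟨$⟩ˡ i) (rotation ⟨$⟩ˡ j) ⊎ _
  back {i} {j} ij = inj₁ (subst₂ (CycSucc _) refl (trans (inverseʳ rotation) i≡) (next-CycSucc (rotation ⟨$⟩ˡ i)))
    where
    i≡ : i ≡ rotation ⟨$⟩ˡ j
    i≡ = trans (sym (inverseˡ rotation)) (cong (rotation ⟨$⟩ˡ_) (next-unique ij))

reflection-∼ : (σ : Permutation′ (suc n)) → (reflection ∘ₚ σ) ∼ σ
reflection-∼ σ =
    ∘-⊑ reflection σ (inj₂ ∘ reflect-CycSucc)
  , λ e → ∘-⊑ reflection (reflection ∘ₚ σ) (inj₂ ∘ reflect-CycSucc)
        (≗⇒⊑ {σ = σ} {reflection ∘ₚ reflection ∘ₚ σ} (λ i → cong (σ ⟨$⟩ʳ_) (sym (reflect-involutive i))) e)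

startAtIndex : (i : Fin (suc n)) (σ : Permutation′ (suc n)) → Σ (Permutation′ (suc n)) λ τ → τ ∼ σ × τ ⟨$⟩ʳ zero ≡ σ ⟨$⟩ʳ i
startAtIndex i σ = go (toℕ i) i σ refl
  where
  -- `k` repeats `toℕ i` as the recursion measure, because `inject₁ i` is not a structural part of
  -- `suc i`.
  go : ∀ {n} k (i : Fin (suc n)) (σ : Permutation′ (suc n)) → toℕ i ≡ k → Σ (Permutation′ (suc n)) λ τ → τ ∼ σ × τ ⟨$⟩ʳ zero ≡ σ ⟨$⟩ʳ i
  go k       zero    σ eq = σ , ((λ e → e) , (λ e → e)) , refl
  go (suc k) (suc i) σ eq =
    let τ , τ∼ , τ0 = go k (inject₁ i) (rotation ∘ₚ σ) (trans (toℕ-inject₁ i) (ℕ.suc-injective eq))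
    in  τ , ∼-trans {ρ = τ} {rotation ∘ₚ σ} {σ} τ∼ (rotation-∼ σ)
      , trans τ0 (cong (σ ⟨$⟩ʳ_) (next-unique (inj₁ (cong suc (toℕ-inject₁ i)))))

startAt : (v : Fin (suc n)) (σ : Permutation′ (suc n)) → Σ (Permutation′ (suc n)) λ τ → τ ∼ σ × τ ⟨$⟩ʳ zero ≡ v
startAt v σ = let τ , τ∼ , τ0 = startAtIndex (σ ⟨$⟩ˡ v) σ in τ , τ∼ , trans τ0 (inverseʳ σ)

-- Induction along the cycle: a vertex has only two neighbours in `τ`, and one of them is the vertex
-- just left, so the next vertex of `σ` must be the other.
⊑-determined : (σ τ : Permutation′ (suc (suc n))) → σ ⊑ τ →
               σ ⟨$⟩ʳ zero ≡ τ ⟨$⟩ʳ zero → σ ⟨$⟩ʳ suc zero ≡ τ ⟨$⟩ʳ suc zero →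
               ∀ i → σ ⟨$⟩ʳ i ≡ τ ⟨$⟩ʳ i
⊑-determined σ τ σ⊑τ eq₀ eq₁ zero    = eq₀
⊑-determined σ τ σ⊑τ eq₀ eq₁ (suc i) = proj₂ (go (toℕ i) i refl)
  where
  go : ∀ k i → toℕ i ≡ k → σ ⟨$⟩ʳ inject₁ i ≡ τ ⟨$⟩ʳ inject₁ i × σ ⟨$⟩ʳ suc i ≡ τ ⟨$⟩ʳ suc i
  go k       zero    _  = eq₀ , eq₁
  go (suc k) (suc i) eq = eqᵢ , eqₛ
    where
    inj≡ : toℕ (inject₁ i) ≡ toℕ i
    inj≡ = toℕ-inject₁ i
    prev = go k (inject₁ i) (trans inj≡ (ℕ.suc-injective eq))
    eqᵢ = proj₂ prev
    at : Fin (suc (suc _))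
    at = suc (inject₁ i)
    step : CycSucc _ at (suc (suc i))
    step = inj₁ (cong (λ t → suc (suc t)) inj≡)
    eqₛ : σ ⟨$⟩ʳ suc (suc i) ≡ τ ⟨$⟩ʳ suc (suc i)
    eqₛ with σ⊑τ (at , suc (suc i) , step , inj₁ (refl , refl))
    ... | a , b , ab , inj₁ (p , q) with refl ← ⟨$⟩ʳ-injective τ (trans p eqᵢ) =
      trans (sym q) (cong (τ ⟨$⟩ʳ_) (CycSucc-functional ab step))
    -- Here the edge leads backwards in `τ`, so `σ` would return to the vertex two positions
    -- earlier.
    ... | a , b , ab , inj₂ (p , q) with refl ← ⟨$⟩ʳ-injective τ (trans q eqᵢ) =
      contradiction (cong toℕ back) (ℕ.<⇒≢ before)
      where
      a≡ : a ≡ inject₁ (inject₁ i)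
      a≡ = CycSucc-injective ab (inj₁ (cong suc (toℕ-inject₁ (inject₁ i))))
      back : inject₁ (inject₁ i) ≡ suc (suc i)
      back = ⟨$⟩ʳ-injective σ (trans (proj₁ prev) (trans (cong (τ ⟨$⟩ʳ_) (sym a≡)) p))
      before : toℕ (inject₁ (inject₁ i)) < suc (suc (toℕ i))
      before = subst (_< suc (suc (toℕ i))) (sym (trans (toℕ-inject₁ (inject₁ i)) inj≡)) (ℕ.m<n⇒m<1+n (ℕ.n<1+n _))

-- Edge sets of cyclic orders

consecutive? : (σ : Permutation′ n) (x y : Fin n) → Dec (Consecutive σ x y)
consecutive? {n} σ x y = any? λ i → any? λ j →
  ((suc (toℕ i) ℕ.≟ toℕ j) ⊎-dec ((suc (toℕ i) ℕ.≟ n) ×-dec (toℕ j ℕ.≟ 0)))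
  ×-dec (((σ ⟨$⟩ʳ i ≟ x) ×-dec (σ ⟨$⟩ʳ j ≟ y)) ⊎-dec ((σ ⟨$⟩ʳ i ≟ y) ×-dec (σ ⟨$⟩ʳ j ≟ x)))

edgeSet : Permutation′ n → EdgeSet n
edgeSet σ = tabulate λ x → tabulate λ y → does (consecutive? σ x y)

does-⇔ : ∀ {p} {P : Set p} (P? : Dec P) → does P? ≡ true ⇔ P
does-⇔ (yes p) = mk⇔ (λ _ → p) (λ _ → refl)
does-⇔ (no ¬p) = mk⇔ (λ ()) (λ p → contradiction p ¬p)

edgeSet-∋ : (σ : Permutation′ n) (x y : Fin n) → edgeSet σ ∋ₑ x , y ≡ true ⇔ Consecutive σ x y
edgeSet-∋ σ x y = subst (λ b → b ≡ true ⇔ Consecutive σ x y) (sym eq) (does-⇔ (consecutive? σ x y))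
  where
  eq : edgeSet σ ∋ₑ x , y ≡ does (consecutive? σ x y)
  eq = trans (cong (λ row → lookup row y) (lookup∘tabulate _ x)) (lookup∘tabulate _ y)

EdgeSet-ext : {E F : EdgeSet n} → (∀ x y → E ∋ₑ x , y ≡ F ∋ₑ x , y) → E ≡ F
EdgeSet-ext eq = vec-ext λ x → vec-ext λ y → eq x y
  where
  vec-ext : ∀ {A : Set} {u v : Vec A n} → (∀ i → lookup u i ≡ lookup v i) → u ≡ v
  vec-ext {u = u} {v} eq = trans (sym (tabulate∘lookup u)) (trans (tabulate-cong eq) (tabulate∘lookup v))

edgeSet-unique : {σ τ : Permutation′ n} {E : EdgeSet n} → σ ∼ τ →
                 (∀ x y → E ∋ₑ x , y ≡ true ⇔ Consecutive τ x y) → edgeSet σ ≡ E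
edgeSet-unique {σ = σ} {τ} (σ⊑τ , τ⊑σ) E∋ = EdgeSet-ext λ x y → ⇔→≡ (mk⇔
  (Equivalence.from (E∋ x y) ∘ σ⊑τ ∘ Equivalence.to (edgeSet-∋ σ x y))
  (Equivalence.from (edgeSet-∋ σ x y) ∘ τ⊑σ ∘ Equivalence.to (E∋ x y)))

edgeSet-⊑ : {σ τ : Permutation′ n} → edgeSet σ ≡ edgeSet τ → σ ⊑ τ
edgeSet-⊑ {σ = σ} {τ} eq {x} {y} e =
  Equivalence.to (edgeSet-∋ τ x y) (trans (cong (_∋ₑ x , y) (sym eq)) (Equivalence.from (edgeSet-∋ σ x y) e))

edgeSet-IsHamCycle : (G : SimpleGraph n) (σ : Permutation′ n) →
                     (∀ {i j} → CycSucc n i j → adj G (σ ⟨$⟩ʳ i) (σ ⟨$⟩ʳ j) ≡ true) →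
                     IsHamCycle G (edgeSet σ)
edgeSet-IsHamCycle G σ adjacent =
  (λ x y → adjacent′ ∘ Equivalence.to (edgeSet-∋ σ x y)) , σ , edgeSet-∋ σ
  where
  adjacent′ : ∀ {x y} → Consecutive σ x y → adj G x y ≡ true
  adjacent′ (i , j , ij , inj₁ (refl , refl)) = adjacent ij
  adjacent′ (i , j , ij , inj₂ (refl , refl)) = trans (adj-sym G _ _) (adjacent ij)

-- Hamiltonian paths on {0, …, m - 1}

-- `f i` is the vertex at position `i`. Vertices are natural numbers, so that shifting labels needs
-- no coercions; that every vertex is visited follows from the first two fields by counting.
record HamPath {m : ℕ} (A : ℕ → ℕ → Set) (f : Fin m → ℕ) : Set where
  field
    bounded   : ∀ i → f i < m
    injective : ∀ {i j} → f i ≡ f j → i ≡ j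
    linked    : ∀ {i j} → suc (toℕ i) ≡ toℕ j → A (f i) (f j)
open HamPath

private
  variable
    A B : ℕ → ℕ → Set

HamPath-reverse : {f : Fin m → ℕ} → (∀ {a b} → A a b → A b a) → HamPath A f → HamPath A (f ∘ opposite)
HamPath-reverse A-sym fp = record
  { bounded   = λ i → bounded fp (opposite i)
  ; injective = λ eq → trans (sym (opposite-involutive _))
                         (trans (cong opposite (injective fp eq)) (opposite-involutive _))
  ; linked    = λ ij → A-sym (linked fp (toℕ-opposite-suc ij))
  }

HamPath-map : (h : ℕ → ℕ) → (∀ {a} → a < m → h a < m) → (∀ {a b} → h a ≡ h b → a ≡ b) →
              (∀ {a b} → A a b → B (h a) (h b)) → {f : Fin m → ℕ} → HamPath A f → HamPath B (h ∘ f)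
HamPath-map h h< h-inj h-A fp = record
  { bounded   = λ i → h< (bounded fp i)
  ; injective = λ eq → injective fp (h-inj eq)
  ; linked    = λ ij → h-A (linked fp ij)
  }

visitsZero : {f : Fin (suc m) → ℕ} → HamPath A f → ∃ λ k → f k ≡ 0
visitsZero fp =
  let k , eq = injective⇒surjective {f = λ i → fromℕ< (bounded fp i)}
                 (λ eq → injective fp (fromℕ<-injective _ _ _ _ eq)) zero
  in  k , trans (sym (toℕ-fromℕ< (bounded fp k))) (cong toℕ eq)

prepend : (Fin m → ℕ) → Fin (suc (suc m)) → ℕ
prepend f zero          = 0
prepend {m} f (suc zero) = suc m
prepend f (suc (suc i)) = suc (f i)

-- Stated for general relations in order to serve both `Thr` and `Thr⁺`.
HamPath-prepend : {f : Fin m → ℕ} → (∀ {a b} → A a b → B (suc a) (suc b)) → B 0 (suc m) →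
                  (∀ a → B (suc m) (suc a)) → HamPath A f → HamPath B (prepend f)
HamPath-prepend {m} {A} {B} {f} lift start join fp = record { bounded = bnd ; injective = inj ; linked = lnk }
  where
  bnd : ∀ i → prepend f i < suc (suc m)
  bnd zero          = s≤s z≤n
  bnd (suc zero)    = ℕ.n<1+n _
  bnd (suc (suc i)) = s≤s (ℕ.m<n⇒m<1+n (bounded fp i))
  inj : ∀ {i j} → prepend f i ≡ prepend f j → i ≡ j
  inj {zero}        {zero}        eq = refl
  inj {zero}        {suc zero}    ()
  inj {zero}        {suc (suc j)} ()
  inj {suc zero}    {zero}        ()
  inj {suc (suc i)} {zero}        ()
  inj {suc zero}    {suc zero}    eq = refl
  inj {suc zero}    {suc (suc j)} eq = contradiction (sym (ℕ.suc-injective eq)) (ℕ.<⇒≢ (bounded fp j))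
  inj {suc (suc i)} {suc zero}    eq = contradiction (ℕ.suc-injective eq) (ℕ.<⇒≢ (bounded fp i))
  inj {suc (suc i)} {suc (suc j)} eq = cong (λ t → suc (suc t)) (injective fp (ℕ.suc-injective eq))
  lnk : ∀ {i j} → suc (toℕ i) ≡ toℕ j → B (prepend f i) (prepend f j)
  lnk {zero}        {suc zero}       eq = start
  lnk {suc zero}    {suc (suc zero)} eq = join _
  lnk {suc (suc i)} {suc (suc j)}    eq = lift (linked fp (ℕ.suc-injective (ℕ.suc-injective eq)))

prepend-cong : {f g : Fin m → ℕ} → (∀ i → f i ≡ g i) → ∀ i → prepend f i ≡ prepend g i
prepend-cong eq zero          = refl
prepend-cong eq (suc zero)    = refl
prepend-cong eq (suc (suc i)) = cong suc (eq i)

-- The relation a + b ≥ m - 1 on the `m` vertices of a path, free of truncated subtraction. On the 3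
-- + m vertices of Gₙ it occurs as `Thr (2 + m)`, that is a + b ≥ m + 1.
Thr : ℕ → ℕ → ℕ → Set
Thr m a b = m ≤ suc (a + b)

Thr-sym : ∀ {a b} → Thr m a b → Thr m b a
Thr-sym {m} {a} {b} = subst (λ t → m ≤ suc t) (ℕ.+-comm a b)

-- Both sides grow by two: removing the least and the greatest of m + 2 labels and shifting down by
-- one gives the same relation on `m` labels.
Thr-suc : ∀ {a b} → Thr m a b → Thr (suc (suc m)) (suc a) (suc b)
Thr-suc {m} {a} {b} ab = s≤s (s≤s (subst (m ≤_) (sym (ℕ.+-suc a b)) ab))

Thr-suc⁻¹ : ∀ {a b} → Thr (suc (suc m)) (suc a) (suc b) → Thr m a b
Thr-suc⁻¹ {m} {a} {b} ab = subst (m ≤_) (ℕ.+-suc a b) (s≤s⁻¹ (s≤s⁻¹ ab))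

HamPath-Thr-prepend : {f : Fin m → ℕ} → HamPath (Thr m) f → HamPath (Thr (suc (suc m))) (prepend f)
HamPath-Thr-prepend {m} = HamPath-prepend Thr-suc ℕ.≤-refl (λ a → s≤s (s≤s (ℕ.m≤m+n m (suc a))))

Thr-zero : ∀ {a} → a < suc (suc m) → Thr (suc (suc m)) 0 a → a ≡ suc m
Thr-zero a< 0a = ℕ.≤-antisym (s≤s⁻¹ a<) (s≤s⁻¹ 0a)

-- A path starting at 0 must continue with m + 1, the only neighbour of 0; what remains lies in {1,
-- ..., m}, which `pred` moves to {0, ..., m - 1}.
fromZero : {f : Fin (suc (suc m)) → ℕ} → HamPath (Thr (suc (suc m))) f → f zero ≡ 0 →
           Σ (Fin m → ℕ) λ g → HamPath (Thr m) g × (∀ i → prepend g i ≡ f i)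
fromZero {m} {f} fp f0 = g , gp , eq
  where
  g : Fin m → ℕ
  g i = pred (f (suc (suc i)))
  f1 : f (suc zero) ≡ suc m
  f1 = Thr-zero (bounded fp _) (subst (λ t → Thr (suc (suc m)) t (f (suc zero))) f0 (linked fp refl))
  suc-pred : ∀ {a} → a ≢ 0 → suc (pred a) ≡ a
  suc-pred {zero}  a≢0 = contradiction refl a≢0
  suc-pred {suc a} _   = refl
  suc-g : ∀ i → suc (g i) ≡ f (suc (suc i))
  suc-g i = suc-pred λ fi≡0 → contradiction (injective fp (trans fi≡0 (sym f0))) λ ()
  gp : HamPath (Thr m) g
  gp = record
    { bounded   = λ i → s≤s⁻¹ (subst (_< suc m) (sym (suc-g i))
                    (ℕ.≤∧≢⇒< (s≤s⁻¹ (bounded fp (suc (suc i))))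
                             (λ fi≡ → contradiction (injective fp (trans fi≡ (sym f1))) λ ())))
    ; injective = λ {i} {j} eq → suc²-injective (injective fp (trans (sym (suc-g i)) (trans (cong suc eq) (suc-g j))))
    ; linked    = λ {i} {j} ij → Thr-suc⁻¹
                    (subst₂ (Thr (suc (suc m))) (sym (suc-g i)) (sym (suc-g j)) (linked fp (cong (λ t → suc (suc t)) ij)))
    }
    where
    suc²-injective : ∀ {i j : Fin m} → _≡_ {A = Fin (suc (suc m))} (suc (suc i)) (suc (suc j)) → i ≡ j
    suc²-injective refl = refl
  eq : ∀ i → prepend g i ≡ f i
  eq zero          = sym f0
  eq (suc zero)    = sym f1
  eq (suc (suc i)) = suc-g i

-- The only possible neighbour of 0 is m + 1.
zeroAtEnd : {f : Fin (suc (suc m)) → ℕ} → HamPath (Thr (suc (suc m))) f →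
            ∀ k → f k ≡ 0 → k ≡ zero ⊎ opposite k ≡ zero
zeroAtEnd fp zero fk = inj₁ refl
zeroAtEnd {m} {f} fp (suc k) fk with suc (suc (toℕ k)) ℕ.≟ suc (suc m)
... | yes last = inj₂ (toℕ-injective (opposite-last last))
... | no ¬last = contradiction (cong toℕ (injective fp (trans before (sym after)))) (ℕ.<⇒≢ distinct)
  where
  k+2< : suc (suc (toℕ k)) < suc (suc m)
  k+2< = ℕ.≤∧≢⇒< (toℕ<n (suc k)) ¬last
  before : f (inject₁ k) ≡ suc m
  before = Thr-zero (bounded fp _) (subst (λ t → Thr (suc (suc m)) t (f (inject₁ k))) fk
             (Thr-sym {a = f (inject₁ k)} (linked fp (cong suc (toℕ-inject₁ k)))))
  after : f (fromℕ< k+2<) ≡ suc m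
  after = Thr-zero (bounded fp _) (subst (λ t → Thr (suc (suc m)) t (f (fromℕ< k+2<))) fk
            (linked fp (sym (toℕ-fromℕ< k+2<))))
  distinct : toℕ (inject₁ k) < toℕ (fromℕ< k+2<)
  distinct = subst₂ _<_ (sym (toℕ-inject₁ k)) (sym (toℕ-fromℕ< k+2<)) (ℕ.m<n⇒m<1+n (ℕ.n<1+n _))

unprepend : {f : Fin (suc (suc m)) → ℕ} → HamPath (Thr (suc (suc m))) f →
            Σ (Fin m → ℕ) λ g → HamPath (Thr m) g ×
              ((∀ i → prepend g i ≡ f i) ⊎ (∀ i → prepend g i ≡ f (opposite i)))
unprepend {m} {f} fp with visitsZero fp
... | k , fk with zeroAtEnd fp k fk
...   | inj₁ refl = let g , gp , eq = fromZero fp fk in g , gp , inj₁ eq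
...   | inj₂ last =
  let g , gp , eq = fromZero (HamPath-reverse (λ {a} → Thr-sym {a = a}) fp)
        (trans (cong f (trans (cong opposite (sym last)) (opposite-involutive k))) fk)
  in  g , gp , inj₂ eq

-- Enumeration of the threshold paths

orient : Fin 2 → (Fin m → ℕ) → Fin m → ℕ
orient zero    f = f
orient (suc _) f = f ∘ opposite

orient-HamPath : ∀ b {f : Fin m → ℕ} → (∀ {a b} → A a b → A b a) → HamPath A f → HamPath A (orient b f)
orient-HamPath zero    A-sym fp = fp
orient-HamPath (suc _) A-sym fp = HamPath-reverse A-sym fp

split : ∀ m → Fin (2 ^ suc m) → Fin 2 × Fin (2 ^ m)
split m = remQuot {2} (2 ^ m)

-- The index `c` codes one binary choice per removed pair of extreme labels: whether 0 stands first
-- or last. A single remaining vertex admits no choice, hence the rounding down.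
zigzag : ∀ m → Fin (2 ^ ⌊ m /2⌋) → Fin m → ℕ
zigzag zero          c = λ ()
zigzag (suc zero)    c = λ _ → 0
zigzag (suc (suc m)) c = let b , d = split ⌊ m /2⌋ c in orient b (prepend (zigzag m d))

zigzag-HamPath : ∀ m c → HamPath (Thr m) (zigzag m c)
zigzag-HamPath zero          c = record { bounded = λ () ; injective = λ { {()} } ; linked = λ { {()} } }
zigzag-HamPath (suc zero)    c = record
  { bounded = λ _ → s≤s z≤n ; injective = λ { {zero} {zero} _ → refl } ; linked = λ _ → s≤s z≤n }
zigzag-HamPath (suc (suc m)) c = let b , d = split ⌊ m /2⌋ c in
  orient-HamPath b (λ {a} → Thr-sym {a = a}) (HamPath-Thr-prepend (zigzag-HamPath m d))

zigzag-complete : ∀ m (f : Fin m → ℕ) → HamPath (Thr m) f → ∃ λ c → ∀ i → zigzag m c i ≡ f i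
-- Stops before the outermost orientation is recorded. Cycles need this form: reversing the whole
-- path does not change the cycle, so there are half as many cycles as paths on m + 2 vertices.
prepend-zigzag-complete : ∀ m (f : Fin (suc (suc m)) → ℕ) → HamPath (Thr (suc (suc m))) f →
  ∃ λ c → (∀ i → prepend (zigzag m c) i ≡ f i) ⊎ (∀ i → prepend (zigzag m c) i ≡ f (opposite i))

prepend-zigzag-complete m f fp with unprepend fp
... | g , gp , inj₁ eq = let c , zg = zigzag-complete m g gp in c , inj₁ λ i → trans (prepend-cong zg i) (eq i)
... | g , gp , inj₂ eq = let c , zg = zigzag-complete m g gp in c , inj₂ λ i → trans (prepend-cong zg i) (eq i)

zigzag-complete zero          f fp = zero , λ ()
zigzag-complete (suc zero)    f fp = zero , λ { zero → sym (ℕ.n<1⇒n≡0 (bounded fp zero)) }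
zigzag-complete (suc (suc m)) f fp with prepend-zigzag-complete m f fp
... | c , inj₁ eq = combine {2} zero c , λ i →
  trans (cong (λ (b , d) → orient b (prepend (zigzag m d)) i) (remQuot-combine {2} zero c)) (eq i)
... | c , inj₂ eq = combine {2} (suc zero) c , λ i →
  trans (cong (λ (b , d) → orient b (prepend (zigzag m d)) i) (remQuot-combine {2} (suc zero) c))
        (trans (eq (opposite i)) (cong f (opposite-involutive i)))

prepend-injective : {f g : Fin m → ℕ} → (∀ i → prepend f i ≡ prepend g i) → ∀ i → f i ≡ g i
prepend-injective eq i = ℕ.suc-injective (eq (suc (suc i)))

prepend-suc≢0 : (f : Fin m → ℕ) → ∀ i → prepend f (suc i) ≢ 0
prepend-suc≢0 f zero    ()
prepend-suc≢0 f (suc i) ()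

-- Position 0 holds vertex 0 exactly when the path is not reversed, so the orientation can be read
-- off there.
orient-prepend-injective : ∀ b b′ {f g : Fin m → ℕ} →
  (∀ i → orient b (prepend f) i ≡ orient b′ (prepend g) i) → b ≡ b′ × (∀ i → f i ≡ g i)
orient-prepend-injective zero       zero       eq = refl , prepend-injective eq
orient-prepend-injective zero       (suc zero) {g = g} eq = contradiction (sym (eq zero)) (prepend-suc≢0 g (fromℕ _))
orient-prepend-injective (suc zero) zero       {f} eq = contradiction (eq zero) (prepend-suc≢0 f (fromℕ _))
orient-prepend-injective (suc zero) (suc zero) {f} {g} eq = refl , prepend-injective λ i →
  subst (λ j → prepend f j ≡ prepend g j) (opposite-involutive i) (eq (opposite i))

zigzag-injective : ∀ m {c d} → (∀ i → zigzag m c i ≡ zigzag m d i) → c ≡ d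
zigzag-injective zero          {zero} {zero} eq = refl
zigzag-injective (suc zero)    {zero} {zero} eq = refl
zigzag-injective (suc (suc m)) {c}    {d}    eq =
  let b≡ , tail≡ = orient-prepend-injective (proj₁ (split ⌊ m /2⌋ c)) (proj₁ (split ⌊ m /2⌋ d)) eq
  in  trans (sym (combine-remQuot {2} (2 ^ ⌊ m /2⌋) c))
        (trans (cong₂ (combine {2}) b≡ (zigzag-injective m tail≡)) (combine-remQuot {2} (2 ^ ⌊ m /2⌋) d))

-- Paths through one additional edge

Thr⁺ : ℕ → ℕ → ℕ → ℕ → ℕ → Set
Thr⁺ m p q a b = Thr m a b ⊎ (a ≡ p × b ≡ q) ⊎ (a ≡ q × b ≡ p)

swap01 : ℕ → ℕ
swap01 zero          = 1
swap01 (suc zero)    = 0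
swap01 (suc (suc a)) = suc (suc a)

swap01-involutive : ∀ a → swap01 (swap01 a) ≡ a
swap01-involutive zero          = refl
swap01-involutive (suc zero)    = refl
swap01-involutive (suc (suc a)) = refl

swap01-< : ∀ {a} → a < suc (suc m) → swap01 a < suc (suc m)
swap01-< {a = zero}        _ = s≤s (s≤s z≤n)
swap01-< {a = suc zero}    _ = s≤s z≤n
swap01-< {a = suc (suc a)} a< = a<

-- Moving 0 up to 1 only helps. Moving 1 down to 0 keeps its edges, except that 1 ~ m + 2 becomes 0
-- ~ m + 2, which misses the bound by one and is the additional edge.
swap01-Thr : ∀ {a b} → Thr (suc (suc (suc (suc m)))) a b →
             Thr⁺ (suc (suc (suc (suc m)))) 0 (suc (suc m)) (swap01 a) (swap01 b)
swap01-Thr {a = zero}     {zero}     (s≤s ())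
swap01-Thr {a = zero}     {suc zero} (s≤s (s≤s ()))
swap01-Thr {a = suc zero} {zero}     (s≤s (s≤s ()))
swap01-Thr {a = suc zero} {suc zero} (s≤s (s≤s (s≤s ())))
swap01-Thr {m} {zero} {suc (suc b)} ab = inj₁ (ℕ.m≤n⇒m≤1+n ab)
swap01-Thr {m} {suc (suc a)} {zero} ab =
  inj₁ (subst (λ t → suc (suc (suc (suc m))) ≤ suc t) (sym (ℕ.+-suc _ 0)) (ℕ.m≤n⇒m≤1+n ab))
swap01-Thr {m} {suc zero} {suc (suc b)} ab with b ℕ.≟ m
... | yes refl = inj₂ (inj₁ (refl , refl))
... | no  b≢m  = inj₁ (s≤s (s≤s (s≤s (ℕ.≤∧≢⇒< (s≤s⁻¹ (s≤s⁻¹ (s≤s⁻¹ (s≤s⁻¹ ab)))) (b≢m ∘ sym)))))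
swap01-Thr {m} {suc (suc a)} {suc zero} ab with a ℕ.≟ m
... | yes refl = inj₂ (inj₂ (refl , refl))
... | no  a≢m  = inj₁ (s≤s (s≤s (s≤s (subst (suc m ≤_) (sym (ℕ.+-identityʳ a)) (ℕ.≤∧≢⇒< m≤a (a≢m ∘ sym))))))
  where
  m≤a : m ≤ a
  m≤a = s≤s⁻¹ (subst (suc m ≤_) (ℕ.+-comm a 1) (s≤s⁻¹ (s≤s⁻¹ (s≤s⁻¹ ab))))
swap01-Thr {m} {suc (suc a)} {suc (suc b)} ab = inj₁ ab

Thr⁺-suc : ∀ {p q a b} → Thr⁺ m p q a b → Thr⁺ (suc (suc m)) (suc p) (suc q) (suc a) (suc b)
Thr⁺-suc {a = a} (inj₁ ab) = inj₁ (Thr-suc {a = a} ab)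
Thr⁺-suc (inj₂ (inj₁ (p , q))) = inj₂ (inj₁ (cong suc p , cong suc q))
Thr⁺-suc (inj₂ (inj₂ (p , q))) = inj₂ (inj₂ (cong suc p , cong suc q))

Traverses : (Fin m → ℕ) → ℕ → ℕ → Set
Traverses f p q = ∃₂ λ i j → suc (toℕ i) ≡ toℕ j × ((f i ≡ p × f j ≡ q) ⊎ (f i ≡ q × f j ≡ p))

-- For p = 0 and m ≥ 2 the path is 1, m + 1, 0, m followed by a path on {2, …, m - 1}.
detour : ∀ m p q → p < q → p + q ≡ m →
         Σ (Fin (suc (suc m)) → ℕ) λ f → HamPath (Thr⁺ (suc (suc m)) p q) f × Traverses f p q
-- Both endpoints drop by one and their sum by two, so the path for the smaller case is reused
-- behind the initial 0, m + 1.
detour _ (suc p) (suc q) p<q refl rewrite ℕ.+-suc p q with detour (p + q) p q (s≤s⁻¹ p<q) refl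
... | f , fp , i , j , ij , ends =
    prepend f
  , HamPath-prepend Thr⁺-suc (inj₁ ℕ.≤-refl) (λ a → inj₁ (s≤s (s≤s (ℕ.m≤m+n (suc (suc (p + q))) (suc a))))) fp
  , suc (suc i) , suc (suc j) , cong (λ t → suc (suc t)) ij
  , Sum.map (Product.map (cong suc) (cong suc)) (Product.map (cong suc) (cong suc)) ends
-- On three vertices, exchanging 0 and 1 in the path 0, 2, 1 would not create the edge 01, so the
-- path 2, 0, 1 is given directly.
detour (suc zero) zero (suc zero) p<q refl = f , fp , suc zero , suc (suc zero) , refl , inj₁ (refl , refl)
  where
  f : Fin 3 → ℕ
  f zero          = 2
  f (suc zero)    = 0
  f (suc (suc _)) = 1
  fp : HamPath (Thr⁺ 3 0 1) f
  fp = record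
    { bounded   = λ { zero → ℕ.≤-refl ; (suc zero) → s≤s z≤n ; (suc (suc zero)) → s≤s (s≤s z≤n) }
    ; injective = λ { {zero} {zero} _ → refl ; {zero} {suc zero} () ; {zero} {suc (suc zero)} ()
                    ; {suc zero} {zero} () ; {suc zero} {suc zero} _ → refl ; {suc zero} {suc (suc zero)} ()
                    ; {suc (suc zero)} {zero} () ; {suc (suc zero)} {suc zero} ()
                    ; {suc (suc zero)} {suc (suc zero)} _ → refl }
    ; linked    = λ { {zero} {suc zero} _ → inj₁ ℕ.≤-refl ; {suc zero} {suc (suc zero)} _ → inj₂ (inj₁ (refl , refl)) }
    }
detour (suc (suc m)) zero (suc (suc m)) p<q refl =
    swap01 ∘ prepend (prepend (zigzag m c))
  , HamPath-map swap01 swap01-< swap01-injective (λ {a} → swap01-Thr {a = a})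
      (HamPath-Thr-prepend (HamPath-Thr-prepend (zigzag-HamPath m c)))
  , suc (suc zero) , suc (suc (suc zero)) , refl , inj₁ (refl , refl)
  where
  c : Fin (2 ^ ⌊ m /2⌋)
  c = fromℕ< (ℕ.m^n>0 2 ⌊ m /2⌋)
  swap01-injective : ∀ {a b} → swap01 a ≡ swap01 b → a ≡ b
  swap01-injective {a} {b} eq =
    trans (sym (swap01-involutive a)) (trans (cong swap01 eq) (swap01-involutive b))

-- Cycles through the vertex m

closed : (f : Fin m → ℕ) → (∀ i → f i < m) → Fin (suc m) → Fin (suc m)
closed {m} f f< zero    = fromℕ m
closed     f f< (suc i) = inject₁ (fromℕ< (f< i))

toℕ-closed : (f : Fin m → ℕ) (f< : ∀ i → f i < m) (i : Fin m) → toℕ (closed f f< (suc i)) ≡ f i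
toℕ-closed f f< i = trans (toℕ-inject₁ _) (toℕ-fromℕ< (f< i))

close : {f : Fin m → ℕ} → HamPath A f → Permutation′ (suc m)
close {m} {f = f} fp = toPermutation (closed f (bounded fp)) inj
  where
  apart : ∀ i → m ≢ f i
  apart i eq = ℕ.<⇒≢ (bounded fp i) (sym eq)
  inj : ∀ {i j} → closed f (bounded fp) i ≡ closed f (bounded fp) j → i ≡ j
  inj {zero}  {zero}  eq = refl
  inj {zero}  {suc j} eq = contradiction
    (trans (sym (toℕ-fromℕ m)) (trans (cong toℕ eq) (toℕ-closed f (bounded fp) j))) (apart j)
  inj {suc i} {zero}  eq = contradiction
    (trans (sym (toℕ-fromℕ m)) (trans (cong toℕ (sym eq)) (toℕ-closed f (bounded fp) i))) (apart i)
  inj {suc i} {suc j} eq = cong suc (injective fp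
    (trans (sym (toℕ-closed f (bounded fp) i)) (trans (cong toℕ eq) (toℕ-closed f (bounded fp) j))))

-- The added vertex at position 0 is related to everything, so the path closes up whatever its ends
-- are. The relation may contain loops; `CycSucc-irrefl` later keeps them out of the graph.
close-linked : {f : Fin (suc m) → ℕ} (fp : HamPath A f) → (∀ {b} → A (suc m) b) → (∀ {a} → A a (suc m)) →
               ∀ {i j} → CycSucc (suc (suc m)) i j → A (toℕ (close fp ⟨$⟩ʳ i)) (toℕ (close fp ⟨$⟩ʳ j))
close-linked {m} {A} fp from into {zero}  {j}     ij = subst (λ t → A t (toℕ (close fp ⟨$⟩ʳ j))) (sym (toℕ-fromℕ (suc m))) from
close-linked {m} {A} fp from into {suc i} {zero}  ij = subst (A _) (sym (toℕ-fromℕ (suc m))) into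
close-linked {m} {A} {f} fp from into {suc i} {suc j} (inj₁ ij) =
  subst₂ A (sym (toℕ-closed f (bounded fp) i)) (sym (toℕ-closed f (bounded fp) j)) (linked fp (ℕ.suc-injective ij))

CycSucc-irrefl : ∀ {i j : Fin (suc (suc n))} → CycSucc (suc (suc n)) i j → i ≢ j
CycSucc-irrefl (inj₁ ij) refl = ℕ.1+n≢n ij
CycSucc-irrefl (inj₂ (last , first)) refl with () ← trans (sym last) (cong suc first)

-- Graphs containing every edge xy with x + y ≥ m + 1, where n = m + 3

-- `G`, read through the labelling `π`, contains Gₙ as a spanning subgraph.
Covers : SimpleGraph (3 + m) → Permutation′ (3 + m) → Set
Covers {m} G π = ∀ x y → x ≢ y → Thr (2 + m) (toℕ x) (toℕ y) → adj G (π ⟨$⟩ʳ x) (π ⟨$⟩ʳ y) ≡ true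

cyclePath : ∀ m c → HamPath (Thr (2 + m)) (prepend (zigzag m c))
cyclePath m c = HamPath-Thr-prepend (zigzag-HamPath m c)

-- The outer pair is prepended without an orientation: the cycle runs m + 2, 0, m + 1, ..., which
-- fixes its start and its direction.
cycle : ∀ m → Fin (2 ^ ⌊ m /2⌋) → Permutation′ (3 + m)
cycle m c = close (cyclePath m c)

cycle-linked : ∀ c {i j} → CycSucc (3 + m) i j → Thr (2 + m) (toℕ (cycle m c ⟨$⟩ʳ i)) (toℕ (cycle m c ⟨$⟩ʳ j))
cycle-linked {m} c = close-linked (cyclePath m c) (ℕ.m≤n⇒m≤1+n (ℕ.m≤m+n _ _)) (λ {a} → ℕ.m≤n⇒m≤1+n (ℕ.m≤n+m _ a))

cycle-distinct : ∀ c {i j} → CycSucc (3 + m) i j → cycle m c ⟨$⟩ʳ i ≢ cycle m c ⟨$⟩ʳ j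
cycle-distinct {m} c ij = CycSucc-irrefl ij ∘ ⟨$⟩ʳ-injective (cycle m c)

cycle-IsHamCycle : (G : SimpleGraph (3 + m)) (π : Permutation′ (3 + m)) → Covers G π →
                   ∀ c → IsHamCycle G (edgeSet (cycle m c ∘ₚ π))
cycle-IsHamCycle {m} G π covers c = edgeSet-IsHamCycle G (cycle m c ∘ₚ π)
  λ ij → covers _ _ (cycle-distinct c ij) (cycle-linked c ij)

-- All these cycles begin with m + 2, 0, so by `⊑-determined` equal edge sets give equal vertex
-- sequences.
edgeSet-cycle-injective : ∀ m (π : Permutation′ (3 + m)) → Injective _≡_ _≡_ λ c → edgeSet (cycle m c ∘ₚ π)
edgeSet-cycle-injective m π {c} {d} eq = zigzag-injective m (prepend-injective λ i →
  trans (sym (toℕ-closed _ (bounded (cyclePath m c)) i))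
        (trans (cong toℕ (⟨$⟩ʳ-injective π (same (suc i)))) (toℕ-closed _ (bounded (cyclePath m d)) i)))
  where
  same : ∀ i → π ⟨$⟩ʳ (cycle m c ⟨$⟩ʳ i) ≡ π ⟨$⟩ʳ (cycle m d ⟨$⟩ʳ i)
  same = ⊑-determined (cycle m c ∘ₚ π) (cycle m d ∘ₚ π) (edgeSet-⊑ {σ = cycle m c ∘ₚ π} {cycle m d ∘ₚ π} eq) refl refl

-- Lower bounds from families of Hamilton cycles

NumHamCycles-≥ : ∀ {K k} (G : SimpleGraph n) → NumHamCycles G k → (e : Fin K → EdgeSet n) →
                 Injective _≡_ _≡_ e → (∀ c → IsHamCycle G (e c)) → K ≤ k
NumHamCycles-≥ {K = K} G (L , _ , L-all , len) e e-inj e-ham = subst (K ≤_) len (injective⇒≤ {f = λ c → index (e∈L c)} ix-inj)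
  where
  e∈L : ∀ c → e c ∈ L
  e∈L c = Equivalence.from (L-all (e c)) (e-ham c)
  ix-inj : Injective _≡_ _≡_ (λ c → index (e∈L c))
  ix-inj eq = e-inj (trans (lookup-index (e∈L _)) (trans (cong (List.lookup L) eq) (sym (lookup-index (e∈L _)))))

Covers⇒≥ : ∀ {k} (G : SimpleGraph (3 + m)) (π : Permutation′ (3 + m)) → Covers G π → NumHamCycles G k → 2 ^ ⌊ m /2⌋ ≤ k
Covers⇒≥ {m} G π covers num =
  NumHamCycles-≥ G num (λ c → edgeSet (cycle m c ∘ₚ π)) (edgeSet-cycle-injective m π) (cycle-IsHamCycle G π covers)

NumHamCycles-> : ∀ {K k} (G : SimpleGraph n) → NumHamCycles G k → (e : Fin K → EdgeSet n) → Injective _≡_ _≡_ e →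
                 (∀ c → IsHamCycle G (e c)) → ∀ {E} → IsHamCycle G E → (∀ c → E ≢ e c) → K < k
NumHamCycles-> {n} {K} G num e e-inj e-ham {E} E-ham E≢ = NumHamCycles-≥ G num e⁺ e⁺-inj e⁺-ham
  where
  e⁺ : Fin (suc K) → EdgeSet n
  e⁺ zero    = E
  e⁺ (suc c) = e c
  e⁺-inj : Injective _≡_ _≡_ e⁺
  e⁺-inj {zero}  {zero}  eq = refl
  e⁺-inj {zero}  {suc d} eq = contradiction eq (E≢ d)
  e⁺-inj {suc c} {zero}  eq = contradiction (sym eq) (E≢ c)
  e⁺-inj {suc c} {suc d} eq = cong suc (e-inj eq)
  e⁺-ham : ∀ c → IsHamCycle G (e⁺ c)
  e⁺-ham zero    = E-ham
  e⁺-ham (suc c) = e-ham c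

Consecutive-cycle : (π : Permutation′ (3 + m)) → ∀ c {p q} →
                    Consecutive (cycle m c ∘ₚ π) (π ⟨$⟩ʳ p) (π ⟨$⟩ʳ q) → Thr (2 + m) (toℕ p) (toℕ q)
Consecutive-cycle {m} π c {p} {q} (a , b , ab , inj₁ (ap , bq)) =
  subst₂ (λ u v → Thr (2 + m) (toℕ u) (toℕ v)) (⟨$⟩ʳ-injective π ap) (⟨$⟩ʳ-injective π bq) (cycle-linked c ab)
Consecutive-cycle {m} π c {p} {q} (a , b , ab , inj₂ (aq , bp)) = Thr-sym {a = toℕ q}
  (subst₂ (λ u v → Thr (2 + m) (toℕ u) (toℕ v)) (⟨$⟩ʳ-injective π aq) (⟨$⟩ʳ-injective π bp) (cycle-linked c ab))

-- Every edge of `cycle m c` has label sum at least m + 1, whereas the edge pq has sum `m`.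
traversing≢cycle : (π δ : Permutation′ (3 + m)) → ∀ p q → toℕ p + toℕ q ≡ m → Consecutive δ (π ⟨$⟩ʳ p) (π ⟨$⟩ʳ q) →
                   ∀ c → edgeSet δ ≢ edgeSet (cycle m c ∘ₚ π)
traversing≢cycle {m} π δ p q p+q uses c eq = ℕ.1+n≰n (subst (λ t → 2 + m ≤ suc t) p+q
  (Consecutive-cycle π c {p} {q} (edgeSet-⊑ {σ = δ} {cycle m c ∘ₚ π} eq uses)))

-- `detour` supplies a path on {0, ..., m + 1} through the edge, and the vertex m + 2 closes it.
extraEdge⇒HamCycle :
  (G : SimpleGraph (3 + m)) (π : Permutation′ (3 + m)) → Covers G π →
  ∀ p q → toℕ p < toℕ q → toℕ p + toℕ q ≡ m → adj G (π ⟨$⟩ʳ p) (π ⟨$⟩ʳ q) ≡ true →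
  Σ (Permutation′ (3 + m)) λ δ → Consecutive δ (π ⟨$⟩ʳ p) (π ⟨$⟩ʳ q) × IsHamCycle G (edgeSet δ)
extraEdge⇒HamCycle {m} G π covers p q p<q p+q pq =
  let f , fp , i , j , ij , ends = detour m (toℕ p) (toℕ q) p<q p+q
      at : ∀ {k r} → f k ≡ toℕ r → π ⟨$⟩ʳ (close fp ⟨$⟩ʳ suc k) ≡ π ⟨$⟩ʳ r
      at = λ {k} eq → cong (π ⟨$⟩ʳ_) (toℕ-injective (trans (toℕ-closed f (bounded fp) k) eq))
  in  close fp ∘ₚ π
    , (suc i , suc j , inj₁ (cong suc ij) , Sum.map (Product.map at at) (Product.map at at) ends)
    , edgeSet-IsHamCycle G (close fp ∘ₚ π) λ ij → adjacent (CycSucc-irrefl ij ∘ ⟨$⟩ʳ-injective (close fp))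
        (close-linked fp (inj₁ (ℕ.m≤n⇒m≤1+n (ℕ.m≤m+n _ _))) (λ {a} → inj₁ (ℕ.m≤n⇒m≤1+n (ℕ.m≤n+m _ a))) ij)
  where
  adjacent : ∀ {x y} → x ≢ y → Thr⁺ (2 + m) (toℕ p) (toℕ q) (toℕ x) (toℕ y) → adj G (π ⟨$⟩ʳ x) (π ⟨$⟩ʳ y) ≡ true
  adjacent x≢y (inj₁ xy) = covers _ _ x≢y xy
  adjacent x≢y (inj₂ (inj₁ (xp , yq))) rewrite toℕ-injective xp | toℕ-injective yq = pq
  adjacent x≢y (inj₂ (inj₂ (xq , yp))) rewrite toℕ-injective xq | toℕ-injective yp = trans (adj-sym G _ _) pq

extraEdge⇒> : ∀ {k} (G : SimpleGraph (3 + m)) (π : Permutation′ (3 + m)) → Covers G π → NumHamCycles G k →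
              ∀ p q → toℕ p < toℕ q → toℕ p + toℕ q ≡ m → adj G (π ⟨$⟩ʳ p) (π ⟨$⟩ʳ q) ≡ true → 2 ^ ⌊ m /2⌋ < k
extraEdge⇒> {m} G π covers num p q p<q p+q pq =
  let δ , uses , δ-ham = extraEdge⇒HamCycle G π covers p q p<q p+q pq
  in  NumHamCycles-> G num (λ c → edgeSet (cycle m c ∘ₚ π)) (edgeSet-cycle-injective m π)
        (cycle-IsHamCycle G π covers) δ-ham (traversing≢cycle π δ p q p+q uses)

-- Sorting

-- Turns a permutation of lists into one of indices, both for sorting weights and for matching
-- degrees; the casts only reconcile lengths.
↭⇒permutation : ∀ {A : Set} {xs : List A} (f : Fin n → A) (len : n ≡ length xs) → xs ↭ List.tabulate f →
                Σ (Permutation′ n) λ π → ∀ i → List.lookup xs (cast len i) ≡ f (π ⟨$⟩ʳ i)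
↭⇒permutation {A = A} {xs} f len xs↭ =
    cast-id len ∘ₚ onIndices xs↭ₛ ∘ₚ cast-id (List.length-tabulate f)
  , λ i → trans (Permutationₛ.onIndices-lookup (setoid A) xs↭ₛ (cast len i)) (unlookup _)
  where
  xs↭ₛ = ↭⇒↭ₛ xs↭
  unlookup : ∀ j → List.lookup (List.tabulate f) j ≡ f (cast (List.length-tabulate f) j)
  unlookup j = trans
    (cong (List.lookup (List.tabulate f))
      (sym (trans (cast-trans (List.length-tabulate f) (sym (List.length-tabulate f)) j) (cast-is-id refl j))))
    (List.lookup-tabulate f _)

sorted : (f : Fin n → ℚ) → Σ (Permutation′ n) λ π → ∀ {x y} → toℕ x ≤ toℕ y → f (π ⟨$⟩ʳ x) ℚ.≤ f (π ⟨$⟩ʳ y)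
sorted f = π , λ {x} {y} x≤y → subst₂ ℚ._≤_ (π-lookup x) (π-lookup y)
  (lookup-mono-≤ (DecTotalOrder.totalOrder ℚ.≤-decTotalOrder) (sort-↗ xs) (subst₂ _≤_ (sym (toℕ-cast len x)) (sym (toℕ-cast len y)) x≤y))
  where
  open Data.List.Sort ℚ.≤-decTotalOrder
  xs  = List.tabulate f
  len = sym (trans (↭-length (sort-↭ xs)) (List.length-tabulate f))
  perm = ↭⇒permutation f len (sort-↭ xs)
  π        = proj₁ perm
  π-lookup = proj₂ perm

-- What later arguments keep of the weights: neighbourhoods are nested along the order `π`. The
-- condition `x′ ≢ y` excludes a loop.
Upward : SimpleGraph n → Permutation′ n → Set
Upward {n} G π = ∀ {x x′ y} → toℕ x ≤ toℕ x′ → x′ ≢ y →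
                 adj G (π ⟨$⟩ʳ x) (π ⟨$⟩ʳ y) ≡ true → adj G (π ⟨$⟩ʳ x′) (π ⟨$⟩ʳ y) ≡ true

adj-irrefl : (G : SimpleGraph n) → ∀ {x y} → adj G x y ≡ true → x ≢ y
adj-irrefl G {x} xy refl with () ← trans (sym xy) (adj-irr G x)

threshold⇒Upward : (G : SimpleGraph n) → IsThreshold G → ∃ (Upward G)
threshold⇒Upward G (f , t , _ , _ , iff) with sorted f
... | π , mono = π , λ {x} {x′} {y} x≤x′ x′≢y xy →
  Equivalence.from (iff _ _ (x′≢y ∘ ⟨$⟩ʳ-injective π))
    (ℚ.<-≤-trans (Equivalence.to (iff _ _ (adj-irrefl G xy)) xy) (ℚ.+-monoˡ-≤ (f (π ⟨$⟩ʳ y)) (mono x≤x′)))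

-- Hamiltonicity

injective-above : ∀ {K b} {h : Fin K → Fin n} → Injective _≡_ _≡_ h → (∀ i → b ≤ toℕ (h i)) → K ≤ n ∸ b
injective-above {n} {b = b} {h} h-inj above = injective⇒≤ {f = λ i → fromℕ< (ℕ.∸-monoˡ-< (toℕ<n (h i)) (above i))}
  λ {i} {j} eq → h-inj (toℕ-injective (ℕ.∸-cancelʳ-≡ (above i) (above j) (fromℕ<-injective _ _ _ _ eq)))

module _ (G : SimpleGraph (suc n)) (π : Permutation′ (suc n)) (upward : Upward G π) where

  private
    _~_ : Fin (suc n) → Fin (suc n) → Set
    x ~ y = adj G (π ⟨$⟩ʳ x) (π ⟨$⟩ʳ y) ≡ true

    ~-sym : ∀ {x y} → x ~ y → y ~ x
    ~-sym xy = trans (adj-sym G _ _) xy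

  -- The endpoints are raised one at a time, and the intermediate pair must not be a loop. If v = x,
  -- `u` goes directly up to `y`; otherwise `u` goes to `x` and then `v` to `y`.
  raise : ∀ {u v x y} → toℕ x < toℕ y → toℕ u ≤ toℕ x → toℕ v ≤ toℕ y → u ≢ v → u ~ v → x ~ y
  raise {u} {v} {x} {y} x<y u≤x v≤y u≢v uv with v ≟ x
  ... | yes refl = ~-sym (upward (ℕ.≤-trans u≤x (ℕ.<⇒≤ x<y)) y≢x uv)
    where
    y≢x : y ≢ x
    y≢x refl = ℕ.<-irrefl refl x<y
  ... | no v≢x   = ~-sym (upward v≤y y≢x (~-sym (upward u≤x (v≢x ∘ sym) uv)))
    where
    y≢x : y ≢ x
    y≢x refl = ℕ.<-irrefl refl x<y

  -- If x ≁ y, every vertex u ≤ x has both cycle neighbours above y. Either some vertex above y follows no u ≤ x,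
  -- so that x + 2 distinct vertices lie above y, or the cycle can never leave the interval (x, y].
  Hamiltonian⇒adjacent : Hamiltonian G → ∀ {x y} → toℕ x < toℕ y → n ≤ suc (toℕ x + toℕ y) → x ~ y
  Hamiltonian⇒adjacent (E , E⊆G , σ₀ , E∋) {x} {y} x<y n≤ with adj G (π ⟨$⟩ʳ x) (π ⟨$⟩ʳ y) in x≁y
  ... | true  = refl
  -- The contradiction appears at vertex 0, found at position `i₀`: the cycle visits it, but
  -- `trapped` would put its label above `x`.
  ... | false = contradiction (proj₁ (trapped (toℕ i₀) i₀ refl)) λ x<τi₀ → ℕ.n≮0 (subst (toℕ x <_) (cong toℕ (inverseʳ τ)) x<τi₀)
    where
    -- `σ` is the given cycle in the sorted labels; `τ` is the same cycle started at `y`.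
    σ = σ₀ ∘ₚ flip π
    start = startAt y σ
    τ = proj₁ start
    i₀ = τ ⟨$⟩ˡ zero

    edge : ∀ {u v} → Consecutive σ u v → u ~ v
    edge (i , j , ij , ends) = E⊆G _ _ (Equivalence.from (E∋ _ _) (i , j , ij , Sum.map (Product.map at at) (Product.map at at) ends))
      where
      at : ∀ {k u} → σ ⟨$⟩ʳ k ≡ u → σ₀ ⟨$⟩ʳ k ≡ π ⟨$⟩ʳ u
      at refl = sym (inverseʳ π)

    step : ∀ {i j} → CycSucc (suc n) i j → (τ ⟨$⟩ʳ i) ~ (τ ⟨$⟩ʳ j)
    step ij = edge (proj₁ (proj₁ (proj₂ start)) (_ , _ , ij , inj₁ (refl , refl)))

    far : ∀ {u v} → toℕ u ≤ toℕ x → u ~ v → toℕ y < toℕ v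
    far {u} {v} u≤x uv with toℕ v ℕ.≤? toℕ y
    ... | no  v≰y = ℕ.≰⇒> v≰y
    ... | yes v≤y = contradiction (trans (sym x≁y) (raise x<y u≤x v≤y (adj-irrefl G uv ∘ cong (π ⟨$⟩ʳ_)) uv)) λ ()

    low : Fin (suc (toℕ x)) → Fin (suc n)
    low u = inject≤ u (toℕ<n x)

    low≤x : ∀ u → toℕ (low u) ≤ toℕ x
    low≤x u = subst (_≤ toℕ x) (sym (toℕ-inject≤ u (toℕ<n x))) (s≤s⁻¹ (toℕ<n u))

    after : Fin (suc n) → Fin (suc n)
    after u = τ ⟨$⟩ʳ next (τ ⟨$⟩ˡ u)

    after-low : ∀ {u} → toℕ u ≤ toℕ x → toℕ y < toℕ (after u)
    after-low {u} u≤x = far u≤x (subst (_~ after u) (inverseʳ τ) (step (next-CycSucc (τ ⟨$⟩ˡ u))))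

    after-injective : ∀ {u v} → after u ≡ after v → u ≡ v
    after-injective {u} {v} eq = ⟨$⟩ʳ-injective (flip τ) (⟨$⟩ʳ-injective rotation (⟨$⟩ʳ-injective τ eq))

    crowded : ∀ {i} → toℕ x < toℕ (τ ⟨$⟩ʳ i) → toℕ y < toℕ (τ ⟨$⟩ʳ next i) → ⊥
    -- `h` lists x + 2 distinct vertices among the n - y above `y`, so x + y + 2 ≤ n, against `n≤`.
    crowded {i} x<τi y<τj = ℕ.1+n≰n (ℕ.≤-trans
      (ℕ.m≤o∸n⇒m+n≤o (suc (suc (toℕ x))) (s≤s⁻¹ (toℕ<n y)) (injective-above h-injective h-above)) n≤)
      where
      h : Fin (suc (suc (toℕ x))) → Fin (suc n)
      h zero    = τ ⟨$⟩ʳ next i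
      h (suc u) = after (low u)
      h-above : ∀ u → suc (toℕ y) ≤ toℕ (h u)
      h-above zero    = y<τj
      h-above (suc u) = after-low (low≤x u)
      fresh : ∀ u → τ ⟨$⟩ʳ next i ≢ after (low u)
      fresh u eq = ℕ.<⇒≱ x<τi (subst (λ v → toℕ v ≤ toℕ x) (sym τi≡) (low≤x u))
        where
        τi≡ : τ ⟨$⟩ʳ i ≡ low u
        τi≡ = trans (cong (τ ⟨$⟩ʳ_) (⟨$⟩ʳ-injective rotation (⟨$⟩ʳ-injective τ eq))) (inverseʳ τ)
      h-injective : Injective _≡_ _≡_ h
      h-injective {zero}  {zero}  eq = refl
      h-injective {zero}  {suc v} eq = contradiction eq (fresh v)
      h-injective {suc u} {zero}  eq = contradiction (sym eq) (fresh u)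
      h-injective {suc u} {suc v} eq = cong suc (inject≤-injective _ _ u v (after-injective eq))

    trapped : ∀ k i → toℕ i ≡ k → toℕ x < toℕ (τ ⟨$⟩ʳ i) × toℕ (τ ⟨$⟩ʳ i) ≤ toℕ y
    trapped k       zero    eq = subst (λ v → toℕ x < toℕ v × toℕ v ≤ toℕ y) (sym (proj₂ (proj₂ start))) (x<y , ℕ.≤-refl)
    trapped (suc k) (suc i) eq with trapped k (inject₁ i) (trans (toℕ-inject₁ i) (ℕ.suc-injective eq))
    ... | x<τi , τi≤y =
        -- Labels up to `x` have only neighbours above `y`, hence cannot follow a vertex of the
        -- interval.
        ℕ.≰⇒> (λ τj≤x → ℕ.<⇒≱ (far τj≤x (~-sym (step ij))) τi≤y)
      , ℕ.≮⇒≥ (λ y<τj → crowded x<τi (subst (λ j → toℕ y < toℕ (τ ⟨$⟩ʳ j)) (sym (next-unique ij)) y<τj))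
      where
      ij : CycSucc (suc n) (inject₁ i) (suc i)
      ij = inj₁ (cong suc (toℕ-inject₁ i))

Hamiltonian⇒Covers : (G : SimpleGraph (3 + m)) (π : Permutation′ (3 + m)) → Upward G π → Hamiltonian G → Covers G π
Hamiltonian⇒Covers G π upward ham x y x≢y xy with <-cmp x y
... | tri< x<y _ _ = Hamiltonian⇒adjacent G π upward ham x<y xy
... | tri≈ _ x≡y _ = contradiction x≡y x≢y
... | tri> _ _ y<x = trans (adj-sym G _ _) (Hamiltonian⇒adjacent G π upward ham y<x (Thr-sym {a = toℕ x} xy))

-- The graph Gₙ

link? : (x y : Fin (3 + m)) → Dec (Thr (2 + m) (toℕ x) (toℕ y) × x ≢ y)
link? {m} x y = (2 + m ℕ.≤? suc (toℕ x + toℕ y)) ×-dec ¬? (x ≟ y)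

link : (x y : Fin (3 + m)) → Bool
link x y = does (link? x y)

link⇔ : (x y : Fin (3 + m)) → link x y ≡ true ⇔ (Thr (2 + m) (toℕ x) (toℕ y) × x ≢ y)
link⇔ x y = does-⇔ (link? x y)

link-sym : (x y : Fin (3 + m)) → link x y ≡ link y x
link-sym {m} x y = ⇔→≡ (mk⇔ (swap x y) (swap y x))
  where
  swap : ∀ (x y : Fin (3 + m)) → link x y ≡ true → link y x ≡ true
  swap x y xy = let thr , x≢y = Equivalence.to (link⇔ x y) xy
                in  Equivalence.from (link⇔ y x) (Thr-sym {a = toℕ x} thr , x≢y ∘ sym)

link-irrefl : (x : Fin (3 + m)) → link x x ≡ false
link-irrefl x = dec-false (link? x x) (λ (_ , x≢x) → x≢x refl)

extremal : ∀ m → SimpleGraph (3 + m)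
extremal m = record { adj = link ; adj-sym = link-sym ; adj-irr = link-irrefl }

extremal-Covers : ∀ m → Covers (extremal m) Permutation.id
extremal-Covers m x y x≢y xy = Equivalence.from (link⇔ x y) (xy , x≢y)

-- Rational weights for Gₙ

weight : ℕ → ℚ
weight zero    = 0ℚ
weight (suc a) = 1ℚ ℚ.+ weight a

0<1 : 0ℚ ℚ.< 1ℚ
0<1 = toWitness {a? = 0ℚ ℚ.<? 1ℚ} _

weight-+ : ∀ a b → weight (a + b) ≡ weight a ℚ.+ weight b
weight-+ zero    b = sym (ℚ.+-identityˡ (weight b))
weight-+ (suc a) b = trans (cong (1ℚ ℚ.+_) (weight-+ a b)) (sym (ℚ.+-assoc 1ℚ (weight a) (weight b)))

weight-≥0 : ∀ a → 0ℚ ℚ.≤ weight a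
weight-≥0 zero    = ℚ.≤-refl
weight-≥0 (suc a) = ℚ.+-mono-≤ (ℚ.<⇒≤ 0<1) (weight-≥0 a)

weight-≤ : ∀ {a b} → a ≤ b → weight a ℚ.≤ weight b
weight-≤ {b = b} z≤n = weight-≥0 b
weight-≤ (s≤s a≤b)   = ℚ.+-monoʳ-≤ 1ℚ (weight-≤ a≤b)

weight-< : ∀ {a b} → a < b → weight a ℚ.< weight b
weight-< {a} a<b = ℚ.<-≤-trans
  (subst (ℚ._< weight (suc a)) (ℚ.+-identityˡ (weight a)) (ℚ.+-monoˡ-< (weight a) 0<1)) (weight-≤ a<b)

-- Each vertex is weighted by its own label and the threshold is `m`: for integers, a sum above `m`
-- is a sum of at least m + 1.
extremal-IsThreshold : ∀ m → IsThreshold (extremal m)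
extremal-IsThreshold m = weight ∘ toℕ , weight m , (λ v → weight-≥0 (toℕ v)) , weight-≥0 m , λ u v u≢v → mk⇔
  (λ uv → subst (weight m ℚ.<_) (weight-+ (toℕ u) (toℕ v)) (weight-< (s≤s⁻¹ (proj₁ (Equivalence.to (link⇔ u v) uv)))))
  (λ m<uv → Equivalence.from (link⇔ u v)
    ( s≤s (ℕ.≰⇒> λ u+v≤m → ℚ.<-irrefl refl (ℚ.<-≤-trans m<uv
        (subst (ℚ._≤ weight m) (weight-+ (toℕ u) (toℕ v)) (weight-≤ u+v≤m))))
    , u≢v))

-- Completeness of the list of cycles of Gₙ

HamCycle⇒path : (σ : Permutation′ (3 + m)) → σ ⟨$⟩ʳ zero ≡ fromℕ (2 + m) →
                (∀ {i j} → CycSucc (3 + m) i j → link (σ ⟨$⟩ʳ i) (σ ⟨$⟩ʳ j) ≡ true) →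
                HamPath (Thr (2 + m)) (λ i → toℕ (σ ⟨$⟩ʳ suc i))
HamCycle⇒path {m} σ σ0 linked = record
  { bounded   = λ i → ℕ.≤∧≢⇒< (s≤s⁻¹ (toℕ<n _)) λ eq → contradiction
      (⟨$⟩ʳ-injective σ (trans (toℕ-injective (trans eq (sym (toℕ-fromℕ (2 + m))))) (sym σ0))) λ ()
  ; injective = λ eq → suc-injective (⟨$⟩ʳ-injective σ (toℕ-injective eq))
  ; linked    = λ {i} {j} ij → proj₁ (Equivalence.to (link⇔ (σ ⟨$⟩ʳ suc i) (σ ⟨$⟩ʳ suc j)) (linked (inj₁ (cong suc ij))))
  }

≗⇒∼ : {σ τ : Permutation′ n} → (∀ i → σ ⟨$⟩ʳ i ≡ τ ⟨$⟩ʳ i) → σ ∼ τ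
≗⇒∼ {σ = σ} {τ} eq = ≗⇒⊑ {σ = σ} {τ} eq , ≗⇒⊑ {σ = τ} {σ} (λ i → sym (eq i))

-- After m + 2 the path has 0 at one of its ends. If 0 comes last, `reflection` turns the cycle
-- round while m + 2 stays in position 0.
cycle-complete : (τ : Permutation′ (3 + m)) → τ ⟨$⟩ʳ zero ≡ fromℕ (2 + m) →
                 HamPath (Thr (2 + m)) (λ i → toℕ (τ ⟨$⟩ʳ suc i)) → ∃ λ c → cycle m c ∼ τ
cycle-complete {m} τ τ0 path with prepend-zigzag-complete m _ path
... | c , inj₁ eq = c , ≗⇒∼ {σ = cycle m c} {τ} λ
  { zero    → sym τ0
  ; (suc i) → toℕ-injective (trans (toℕ-closed _ (bounded (cyclePath m c)) i) (eq i)) }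
... | c , inj₂ eq = c , ∼-trans {ρ = cycle m c} {reflection ∘ₚ τ} {τ}
  (≗⇒∼ {σ = cycle m c} {reflection ∘ₚ τ} λ
    { zero    → sym τ0
    ; (suc i) → toℕ-injective (trans (toℕ-closed _ (bounded (cyclePath m c)) i) (eq i)) })
  (reflection-∼ τ)

extremal-complete : ∀ m E → IsHamCycle (extremal m) E → ∃ λ c → E ≡ edgeSet (cycle m c ∘ₚ Permutation.id)
extremal-complete m E (E⊆G , σ , E∋) =
  let τ , τ∼σ , τ0 = startAt (fromℕ (2 + m)) σ
      c , c∼τ      = cycle-complete τ τ0 (HamCycle⇒path τ τ0 λ ij →
        E⊆G _ _ (Equivalence.from (E∋ _ _) (proj₁ τ∼σ (_ , _ , ij , inj₁ (refl , refl)))))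
      c∼σ = ∼-trans {ρ = cycle m c} {τ} {σ} c∼τ τ∼σ
  in  c , sym (edgeSet-unique {σ = cycle m c ∘ₚ Permutation.id} {σ} c∼σ E∋)

extremal-NumHamCycles : ∀ m → NumHamCycles (extremal m) (2 ^ ⌊ m /2⌋)
extremal-NumHamCycles m = List.tabulate e
  , Unique.tabulate⁺ (edgeSet-cycle-injective m Permutation.id)
  , (λ E → mk⇔ (λ E∈ → let c , E≡ = ∈-tabulate⁻ E∈ in subst (IsHamCycle (extremal m)) (sym E≡) (e-ham c))
               (λ E-ham → let c , E≡ = extremal-complete m E E-ham in subst (_∈ List.tabulate e) (sym E≡) (∈-tabulate⁺ c)))
  , List.length-tabulate e
  where
  e : Fin (2 ^ ⌊ m /2⌋) → EdgeSet (3 + m)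
  e c = edgeSet (cycle m c ∘ₚ Permutation.id)
  e-ham : ∀ c → IsHamCycle (extremal m) (e c)
  e-ham = cycle-IsHamCycle (extremal m) Permutation.id (extremal-Covers m)

extremal-Hamiltonian : ∀ m → Hamiltonian (extremal m)
extremal-Hamiltonian m =
  edgeSet (cycle m c ∘ₚ Permutation.id) , cycle-IsHamCycle (extremal m) Permutation.id (extremal-Covers m) c
  where c = fromℕ< (ℕ.m^n>0 2 ⌊ m /2⌋)

-- Degrees

ind : Bool → ℕ
ind b = if b then 1 else 0

ind-mono : ∀ {b c} → (b ≡ true → c ≡ true) → ind b ≤ ind c
ind-mono {false} {c}     _   = z≤n
ind-mono {true}  {false} b⇒c with () ← b⇒c refl
ind-mono {true}  {true}  _   = ℕ.≤-refl

ind-injective : ∀ {b c} → ind b ≡ ind c → b ≡ c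
ind-injective {false} {false} _ = refl
ind-injective {true}  {true}  _ = refl

sum-tabulate : (t : Fin n → ℕ) → ListAction.sum (List.tabulate t) ≡ sum t
sum-tabulate {zero}  t = refl
sum-tabulate {suc n} t = cong (t zero +_) (sum-tabulate (t ∘ suc))

deg-sum : (G : SimpleGraph n) (v : Fin n) → deg G v ≡ sum (λ w → ind (adj G v w))
deg-sum G v = trans (cong ListAction.sum (List.map-tabulate id (λ w → ind (adj G v w)))) (sum-tabulate (λ w → ind (adj G v w)))

sum-mono : {t u : Fin n → ℕ} → (∀ i → t i ≤ u i) → sum t ≤ sum u
sum-mono {zero}  t≤u = z≤n
sum-mono {suc n} t≤u = ℕ.+-mono-≤ (t≤u zero) (sum-mono (t≤u ∘ suc))

sum-≤-≡ : {t u : Fin n → ℕ} → (∀ i → t i ≤ u i) → sum t ≡ sum u → ∀ i → t i ≡ u i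
sum-≤-≡ {suc n} {t} {u} t≤u eq = go
  where
  head≡ : t zero ≡ u zero
  head≡ = ℕ.≤-antisym (t≤u zero) (ℕ.≮⇒≥ λ t<u → ℕ.<⇒≢ (ℕ.+-mono-<-≤ t<u (sum-mono (t≤u ∘ suc))) eq)
  go : ∀ i → t i ≡ u i
  go zero    = head≡
  go (suc i) = sum-≤-≡ (t≤u ∘ suc) (ℕ.+-cancelˡ-≡ (t zero) _ _ (trans eq (cong (_+ sum (u ∘ suc)) (sym head≡)))) i

-- A neighbourhood contained in another of the same size equals it; this is how equal degrees yield
-- equal adjacencies.
row-≡ : {p q : Fin n → Bool} → (∀ i → p i ≡ true → q i ≡ true) →
        sum (ind ∘ p) ≡ sum (ind ∘ q) → ∀ i → p i ≡ q i
row-≡ p⇒q eq i = ind-injective (sum-≤-≡ (λ i → ind-mono (p⇒q i)) eq i)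

-- Rows below k force the rows from m + 1 - k on (their non-edges are known), and these in turn
-- force row k (its edges are known).
degrees-determine-link :
  (h : Fin (3 + m) → Fin (3 + m) → Bool) → (∀ x y → h x y ≡ h y x) → (∀ x → h x x ≡ false) →
  (∀ x → sum (ind ∘ h x) ≡ sum (ind ∘ link x)) → ∀ x y → h x y ≡ link x y
degrees-determine-link {m} h h-sym h-irrefl degrees x y = below (suc (toℕ x)) x y (ℕ.n<1+n _)
  where
  below : ∀ k x y → toℕ x < k → h x y ≡ link x y
  above : ∀ k x y → Thr (2 + m) (toℕ x) k → h x y ≡ link x y

  above k x = λ y thr → row-≡ (known thr) (degrees x) y
    where
    known : Thr (2 + m) (toℕ x) k → ∀ y → h x y ≡ true → link x y ≡ true
    known thr y xy with toℕ y ℕ.<? k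
    ... | yes y<k = trans (link-sym x y) (trans (sym (below k y x y<k)) (trans (h-sym y x) xy))
    ... | no  y≮k = Equivalence.from (link⇔ x y)
      ( ℕ.≤-trans thr (s≤s (ℕ.+-monoʳ-≤ (toℕ x) (ℕ.≮⇒≥ y≮k)))
      , λ { refl → contradiction (trans (sym xy) (h-irrefl x)) λ () })

  below (suc k) x y x≤k = sym (row-≡ known (sym (degrees x)) y)
    where
    known : ∀ y → link x y ≡ true → h x y ≡ true
    known y xy = trans (h-sym x y) (trans (above k y x thr) (trans (link-sym y x) xy))
      where
      thr : Thr (2 + m) (toℕ y) k
      thr = ℕ.≤-trans (Thr-sym {a = toℕ x} (proj₁ (Equivalence.to (link⇔ x y) xy)))
                      (s≤s (ℕ.+-monoʳ-≤ (toℕ y) (s≤s⁻¹ x≤k)))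

-- Degree sequence of Gₙ

sum-above : ∀ n c b → sum {n} (λ y → ind (does (c ℕ.≤? b + toℕ y))) ≡ n ∸ (c ∸ b)
sum-above zero    c b = sym (ℕ.0∸n≡0 (c ∸ b))
sum-above (suc n) c b = trans (cong₂ _+_ (cong (λ t → ind (does (c ℕ.≤? t))) (ℕ.+-identityʳ b)) tail≡) (total (c ℕ.≤? b))
  where
  -- Dropping the first summand turns the offset `b` into `suc b`, which is why `b` is a parameter.
  tail≡ : sum {n} (λ y → ind (does (c ℕ.≤? b + suc (toℕ y)))) ≡ n ∸ (c ∸ suc b)
  tail≡ = trans (sum-cong-≗ {n} (λ y → cong (λ t → ind (does (c ℕ.≤? t))) (ℕ.+-suc b (toℕ y)))) (sum-above n c (suc b))
  total : (d : Dec (c ≤ b)) → ind (does d) + (n ∸ (c ∸ suc b)) ≡ suc n ∸ (c ∸ b)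
  total (yes c≤b) = trans (cong (λ t → suc (n ∸ t)) (ℕ.m≤n⇒m∸n≡0 (ℕ.m≤n⇒m≤1+n c≤b)))
                          (cong (suc n ∸_) (sym (ℕ.m≤n⇒m∸n≡0 c≤b)))
  total (no c≰b)  = cong (suc n ∸_) (sym (ℕ.+-∸-assoc 1 (ℕ.≰⇒> c≰b)))

-- Counts all y with a + y ≥ m + 1, then removes y = a itself where a + a already reaches that
-- bound.
extremalDegree : ℕ → ℕ → ℕ
extremalDegree m a = (3 + m) ∸ (suc m ∸ a) ∸ ind (does (2 + m ℕ.≤? suc (a + a)))

link-≢ : (x y : Fin (3 + m)) → x ≢ y → link x y ≡ does (2 + m ℕ.≤? suc (toℕ x + toℕ y))
link-≢ {m} x y x≢y = ⇔→≡ (mk⇔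
  (dec-true (2 + m ℕ.≤? suc (toℕ x + toℕ y)) ∘ proj₁ ∘ Equivalence.to (link⇔ x y))
  (λ eq → Equivalence.from (link⇔ x y) (Equivalence.to (does-⇔ (2 + m ℕ.≤? suc (toℕ x + toℕ y))) eq , x≢y)))

deg-extremal : (x : Fin (3 + m)) → deg (extremal m) x ≡ extremalDegree m (toℕ x)
deg-extremal {m} x = begin
  deg (extremal m) x                              ≡⟨ deg-sum (extremal m) x ⟩
  sum (ind ∘ link x)                              ≡⟨ sum-remove {i = x} (ind ∘ link x) ⟩
  ind (link x x) + sum (ind ∘ link x ∘ punchIn x) ≡⟨ cong₂ _+_ (cong ind (link-irrefl x)) (sum-cong-≗ off-diagonal) ⟩
  sum (ind ∘ thr ∘ punchIn x)                     ≡⟨ ℕ.m+n∸m≡n (ind (thr x)) _ ⟨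
  ind (thr x) + sum (ind ∘ thr ∘ punchIn x) ∸ ind (thr x)
    ≡⟨ cong (_∸ ind (thr x)) (sum-remove {i = x} (ind ∘ thr)) ⟨
  sum (ind ∘ thr) ∸ ind (thr x)                   ≡⟨ cong (_∸ ind (thr x)) (sum-above (3 + m) (2 + m) (suc (toℕ x))) ⟩
  extremalDegree m (toℕ x)                        ∎
  where
  open ≡-Reasoning
  thr : Fin (3 + m) → Bool
  thr y = does (2 + m ℕ.≤? suc (toℕ x + toℕ y))
  off-diagonal : ∀ j → ind (link x (punchIn x j)) ≡ ind (thr (punchIn x j))
  off-diagonal j = cong ind (link-≢ x (punchIn x j) (punchInᵢ≢i x j ∘ sym))

applyUpTo-cong : ∀ {A : Set} {f g : ℕ → A} k → (∀ {i} → i < k → f i ≡ g i) → applyUpTo f k ≡ applyUpTo g k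
applyUpTo-cong zero    eq = refl
applyUpTo-cong (suc k) eq = cong₂ _∷_ (eq (s≤s z≤n)) (applyUpTo-cong k (λ i<k → eq (s≤s i<k)))

applyUpTo-+ : ∀ {A : Set} (f : ℕ → A) a b → applyUpTo f (a + b) ≡ applyUpTo f a ++ applyUpTo (f ∘ (a +_)) b
applyUpTo-+ f zero    b = refl
applyUpTo-+ f (suc a) b = cong (f 0 ∷_) (applyUpTo-+ (f ∘ suc) a b)

tabulate-toℕ : ∀ {A : Set} (f : ℕ → A) k → List.tabulate {n = k} (f ∘ toℕ) ≡ applyUpTo f k
tabulate-toℕ f zero    = refl
tabulate-toℕ f (suc k) = cong (f 0 ∷_) (tabulate-toℕ (f ∘ suc) k)

module _ (m : ℕ) where

  private
    D : ℕ → ℕ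
    D = extremalDegree m
    M h h′ : ℕ
    M  = suc m
    -- The least `a` with a + a ≥ M. From there on the diagonal term lowers the degree by one, so
    -- degree h + 1 occurs both at h - 1 and at `h`.
    h  = ⌈ M /2⌉
    h′ = ⌊ M /2⌋

    h+h′ : h + h′ ≡ M
    h+h′ = trans (ℕ.+-comm h h′) (ℕ.⌊n/2⌋+⌈n/2⌉≡n M)

    h≤1+h′ : h ≤ suc h′
    h≤1+h′ = ℕ.⌊n/2⌋-mono (ℕ.n≤1+n (suc M))

    full : ∀ {a} → a ≤ M → (2 + M) ∸ (M ∸ a) ≡ 2 + a
    full {a} a≤M = trans (ℕ.+-∸-assoc 2 (ℕ.m∸n≤m M a)) (cong (2 +_) (ℕ.m∸[m∸n]≡n a≤M))

    diagonal : ∀ {a} → M ≤ a + a → D a ≡ (2 + M) ∸ (M ∸ a) ∸ 1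
    diagonal {a} M≤ = cong (λ b → (2 + M) ∸ (M ∸ a) ∸ ind b) (dec-true (suc M ℕ.≤? suc (a + a)) (s≤s M≤))

    D-low : ∀ {a} → a < h → D a ≡ 2 + a
    D-low {a} a<h = trans
      (cong (λ b → (2 + M) ∸ (M ∸ a) ∸ ind b) (dec-false (suc M ℕ.≤? suc (a + a)) λ M≤ → ℕ.<⇒≱ a+a<M (s≤s⁻¹ M≤)))
      (full (ℕ.≤-trans (ℕ.<⇒≤ a<h) (ℕ.⌈n/2⌉≤n M)))
      where
      a+a<M : a + a < M
      a+a<M = subst (a + a <_) h+h′ (ℕ.+-mono-<-≤ a<h (s≤s⁻¹ (ℕ.≤-trans a<h h≤1+h′)))

    D-mid : ∀ {a} → h ≤ a → a ≤ M → D a ≡ 1 + a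
    D-mid {a} h≤a a≤M = trans
      (diagonal {a} (subst (_≤ a + a) h+h′ (ℕ.+-mono-≤ h≤a (ℕ.≤-trans (ℕ.⌊n/2⌋≤⌈n/2⌉ M) h≤a))))
      (cong (_∸ 1) (full a≤M))

    -- Here `M ∸ suc M` is truncated to 0, so the degree stops growing and M + 1 = n - 1 occurs a
    -- second time.
    D-top : D (suc M) ≡ suc M
    D-top = trans (diagonal {suc M} (ℕ.≤-trans (ℕ.n≤1+n M) (ℕ.m≤m+n (suc M) (suc M))))
                  (cong (λ t → (2 + M) ∸ t ∸ 1) (ℕ.m≤n⇒m∸n≡0 (ℕ.n≤1+n M)))

    low high : List ℕ
    low  = applyUpTo (2 +_) h
    high = applyUpTo (λ b → 2 + (h + b)) h′

    degrees : List.map (deg (extremal m)) (allFin (3 + m)) ≡ (low ++ suc h ∷ high) ++ suc M ∷ []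
    degrees = begin
      List.map (deg (extremal m)) (allFin (3 + m))    ≡⟨ List.map-tabulate id (deg (extremal m)) ⟩
      List.tabulate (deg (extremal m))                ≡⟨ List.tabulate-cong deg-extremal ⟩
      List.tabulate {n = 3 + m} (D ∘ toℕ)             ≡⟨ tabulate-toℕ D (3 + m) ⟩
      applyUpTo D (2 + M)                             ≡⟨ List.applyUpTo-∷ʳ D (suc M) ⟨
      applyUpTo D (suc M) ++ D (suc M) ∷ []           ≡⟨ cong₂ (λ k d → applyUpTo D k ++ d ∷ []) 1+M≡ D-top ⟩
      applyUpTo D (h + suc h′) ++ suc M ∷ []          ≡⟨ cong (_++ suc M ∷ []) (applyUpTo-+ D h (suc h′)) ⟩
      (applyUpTo D h ++ applyUpTo (D ∘ (h +_)) (suc h′)) ++ suc M ∷ []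
        ≡⟨ cong (_++ suc M ∷ []) (cong₂ _++_ (applyUpTo-cong h D-low) (cong₂ _∷_ D-h (applyUpTo-cong h′ D-high))) ⟩
      (low ++ suc h ∷ high) ++ suc M ∷ []             ∎
      where
      open ≡-Reasoning
      1+M≡ : suc M ≡ h + suc h′
      1+M≡ = trans (cong suc (sym h+h′)) (sym (ℕ.+-suc h h′))
      D-h : D (h + 0) ≡ suc h
      D-h = trans (cong D (ℕ.+-identityʳ h)) (D-mid ℕ.≤-refl (ℕ.⌈n/2⌉≤n M))
      D-high : ∀ {b} → b < h′ → D (h + suc b) ≡ 2 + (h + b)
      D-high {b} b<h′ = trans
        (D-mid (ℕ.m≤m+n h (suc b)) (subst (h + suc b ≤_) h+h′ (ℕ.+-monoʳ-≤ h b<h′)))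
        (cong suc (ℕ.+-suc h b))

    gnDegrees : GnDegrees (3 + m) ≡ suc M ∷ suc h ∷ low ++ high
    gnDegrees = cong (λ ds → suc M ∷ suc h ∷ ds) (begin
      List.map (λ i → i + 2) (upTo M)  ≡⟨ List.map-upTo (λ i → i + 2) M ⟩
      applyUpTo (λ i → i + 2) M        ≡⟨ applyUpTo-cong M (λ {i} _ → ℕ.+-comm i 2) ⟩
      applyUpTo (2 +_) M               ≡⟨ cong (applyUpTo (2 +_)) h+h′ ⟨
      applyUpTo (2 +_) (h + h′)        ≡⟨ applyUpTo-+ (2 +_) h h′ ⟩
      low ++ high                      ∎)
      where open ≡-Reasoning

  extremal-HasGnDegreeSequence : HasGnDegreeSequence (extremal m)
  extremal-HasGnDegreeSequence = subst₂ _↭_ (sym degrees) (sym gnDegrees)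
    (↭-trans (++-comm (low ++ suc h ∷ high) (suc M ∷ [])) (prep (suc M) (shift (suc h) low high)))

-- Recognising Gₙ

-- Matching equal degrees gives `ρ`; then `degrees-determine-link` recognises Gₙ in `H` read through
-- `ρ`.
degreeSequence⇒link : (H : SimpleGraph (3 + m)) → HasGnDegreeSequence H →
                      Σ (Permutation′ (3 + m)) λ ρ → ∀ x y → adj H (ρ ⟨$⟩ʳ x) (ρ ⟨$⟩ʳ y) ≡ link x y
degreeSequence⇒link {m} H seq = ρ , degrees-determine-link (λ x y → adj H (ρ ⟨$⟩ʳ x) (ρ ⟨$⟩ʳ y))
  (λ x y → adj-sym H _ _) (λ x → adj-irr H _) (λ x → begin
    sum (λ y → ind (adj H (ρ ⟨$⟩ʳ x) (ρ ⟨$⟩ʳ y))) ≡⟨ sum-permute (λ y → ind (adj H (ρ ⟨$⟩ʳ x) y)) ρ ⟨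
    sum (λ y → ind (adj H (ρ ⟨$⟩ʳ x) y))          ≡⟨ deg-sum H (ρ ⟨$⟩ʳ x) ⟨
    deg H (ρ ⟨$⟩ʳ x)                              ≡⟨ ρ-deg x ⟨
    List.lookup xs (cast len x)                   ≡⟨ List.lookup-tabulate (deg (extremal m)) x ⟩
    deg (extremal m) x                            ≡⟨ deg-sum (extremal m) x ⟩
    sum (ind ∘ link x)                            ∎)
  where
  open ≡-Reasoning
  xs : List ℕ
  xs = List.tabulate (deg (extremal m))
  len : 3 + m ≡ length xs
  len = sym (List.length-tabulate (deg (extremal m)))
  perm = ↭⇒permutation (deg H) len (subst₂ _↭_ (List.map-tabulate id (deg (extremal m))) (List.map-tabulate id (deg H))
           (↭-trans (extremal-HasGnDegreeSequence m) (↭-sym seq)))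
  ρ     = proj₁ perm
  ρ-deg = proj₂ perm

-- By `extraEdge⇒>` an edge with label sum exactly `m` would give too many cycles, and an edge of
-- smaller sum yields one of sum `m` by raising its upper endpoint.
minimal⇒link : (G : SimpleGraph (3 + m)) → IsThreshold G → Hamiltonian G → NumHamCycles G (2 ^ ⌊ m /2⌋) →
               Σ (Permutation′ (3 + m)) λ π → ∀ x y → adj G (π ⟨$⟩ʳ x) (π ⟨$⟩ʳ y) ≡ link x y
minimal⇒link {m} G thr ham num = π , λ x y → ⇔→≡ (mk⇔
  (λ xy → Equivalence.from (link⇔ x y) (forced x y xy , adj-irrefl G xy ∘ cong (π ⟨$⟩ʳ_)))
  (λ xy → let t , x≢y = Equivalence.to (link⇔ x y) xy in covers x y x≢y t))
  where
  π      = proj₁ (threshold⇒Upward G thr)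
  upward = proj₂ (threshold⇒Upward G thr)
  covers = Hamiltonian⇒Covers G π upward ham
  noExtra : ∀ {x y} → toℕ x < toℕ y → adj G (π ⟨$⟩ʳ x) (π ⟨$⟩ʳ y) ≡ true → Thr (2 + m) (toℕ x) (toℕ y)
  noExtra {x} {y} x<y xy = ℕ.≰⇒> λ x+y<2+m → impossible (s≤s⁻¹ x+y<2+m)
    where
    impossible : toℕ x + toℕ y ≤ m → ⊥
    impossible x+y≤m = ℕ.<-irrefl refl (extraEdge⇒> G π covers num x y′ x<y′
      (trans (cong (toℕ x +_) y′≡) (ℕ.m+[n∸m]≡n x≤m)) (trans (adj-sym G _ _) y′x))
      where
      x≤m : toℕ x ≤ m
      x≤m = ℕ.≤-trans (ℕ.m≤m+n (toℕ x) (toℕ y)) x+y≤m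
      y′ : Fin (3 + m)
      y′ = fromℕ< {m ∸ toℕ x} (ℕ.≤-trans (s≤s (ℕ.m∸n≤m m (toℕ x))) (ℕ.m≤n+m (suc m) 2))
      y′≡ : toℕ y′ ≡ m ∸ toℕ x
      y′≡ = toℕ-fromℕ< _
      y≤y′ : toℕ y ≤ toℕ y′
      y≤y′ = subst (toℕ y ≤_) (sym y′≡) (ℕ.m+n≤o⇒m≤o∸n (toℕ y) (subst (_≤ m) (ℕ.+-comm (toℕ x) (toℕ y)) x+y≤m))
      x<y′ : toℕ x < toℕ y′
      x<y′ = ℕ.<-≤-trans x<y y≤y′
      y′x : adj G (π ⟨$⟩ʳ y′) (π ⟨$⟩ʳ x) ≡ true
      y′x = upward y≤y′ (λ y′≡x → ℕ.<⇒≢ x<y′ (cong toℕ (sym y′≡x))) (trans (adj-sym G _ _) xy)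
  forced : ∀ x y → adj G (π ⟨$⟩ʳ x) (π ⟨$⟩ʳ y) ≡ true → Thr (2 + m) (toℕ x) (toℕ y)
  forced x y xy with <-cmp x y
  ... | tri< x<y _ _ = noExtra x<y xy
  ... | tri≈ _ x≡y _ = contradiction (cong (π ⟨$⟩ʳ_) x≡y) (adj-irrefl G xy)
  ... | tri> _ _ y<x = Thr-sym {a = toℕ y} (noExtra y<x (trans (adj-sym G _ _) xy))

theorem6 : (n : ℕ) → 3 ≤ n →
    ((G : SimpleGraph n) (k : ℕ) → IsThreshold G → Hamiltonian G →
    NumHamCycles G k → 2 ^ ⌊ (n ∸ 3) /2⌋ ≤ k)
    × Σ (SimpleGraph n) (λ G → HasGnDegreeSequence G × IsThreshold G ×
    Hamiltonian G × NumHamCycles G (2 ^ ⌊ (n ∸ 3) /2⌋))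
    × ((G H : SimpleGraph n) → IsThreshold G → Hamiltonian G →
    NumHamCycles G (2 ^ ⌊ (n ∸ 3) /2⌋) → HasGnDegreeSequence H → G ≅ H)
theorem6 .(3 + m) (s≤s (s≤s (s≤s (z≤n {m})))) =
    (λ G k thr ham num → let π , upward = threshold⇒Upward G thr
                         in  Covers⇒≥ G π (Hamiltonian⇒Covers G π upward ham) num)
  , ( extremal m , extremal-HasGnDegreeSequence m , extremal-IsThreshold m
    , extremal-Hamiltonian m , extremal-NumHamCycles m )
  , λ G H thr ham num seq →
      let π , π-link = minimal⇒link G thr ham num
          ρ , ρ-link = degreeSequence⇒link H seq
      -- `flip ρ` sends a vertex of `H` to its label in Gₙ, and `π` sends that label to a vertex of
      -- `G`.
      in  flip ρ ∘ₚ π , λ x y → trans (π-link (ρ ⟨$⟩ˡ x) (ρ ⟨$⟩ˡ y))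
            (trans (sym (ρ-link (ρ ⟨$⟩ˡ x) (ρ ⟨$⟩ˡ y))) (cong₂ (adj H) (inverseʳ ρ) (inverseʳ ρ)))
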